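{- Let $g\ge3$, $d\ge3$, and let $S_{g,d}$ be the cycle $C_g$ with $d-2$ pendant leaves at each cycle vertex. Then $S_{g,d}$ admits no discrete Einstein metric with a non-geodesic cycle edge, i.e. no discrete Einstein metric $w$ in which some cycle edge has weight strictly greater than $\tfrac12L$, where $L$ is the total weight of the cycle edges.
   Context: Weighted graphs: $G=(V,E)$ is a finite connected simple graph, $w:E\to\mathbb{R}_{>0}$ an edge weighting, $d_v$ the combinatorial degree, and $d(x,y)$ the least total weight of a path from $x$ to $y$. Lin--Lu--Yau curvature: for $\alpha\in[0,1]$ let $\mu_x^\alpha$ be the probability measure with mass $\alpha$ at $x$ and $(1-\alpha)/d_x$ at each neighbour of $x$. Let $W$ be the $L^1$-Wasserstein distance with respect to $d$. For an edge $x\sim y$ put $\kappa_\alpha(x,y)=1-W(\mu_x^\alpha,\mu_y^\alpha)/d(x,y)$ (note the normalisation by the distance $d(x,y)$, not the edge weight) and $\kappa_{xy}=\lim_{\alpha\to1}\kappa_\alpha(x,y)/(1-\alpha)$. A positive weighting $w$ is a discrete Einstein metric if there is a real $\kappa$ with $\kappa_e=\kappa$ for every edge $e$. -}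

module Defs where

open import Algebra.Bundles using (CommutativeRing)
import Algebra.Definitions.RawMonoid as RawMonoid
open import Data.Bool.Base using (if_then_else_)
open import Data.Empty using (⊥)
open import Data.Fin.Base using (Fin; toℕ; fromℕ<)
open import Data.Fin.Properties using (toℕ-fromℕ<; toℕ-injective; toℕ<n; fromℕ<-toℕ)
  renaming (_≟_ to _≟ᶠ_)
open import Data.List.Base using (List; foldr; length; filter; map; _++_; allFin; cartesianProduct)
open import Data.List.Membership.Propositional using (_∈_)
open import Data.List.Membership.Propositional.Properties
  using (∈-map⁺; ∈-map⁻; ∈-++⁺ˡ; ∈-++⁺ʳ; ∈-allFin; ∈-cartesianProduct⁺)
open import Data.List.Relation.Unary.Unique.Propositional using (Unique)
import Data.List.Relation.Unary.Unique.Propositional.Properties as Unique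
open import Data.Nat.Base as ℕ using (ℕ; zero; suc; _∸_; s≤s; z≤n)
import Data.Nat.Properties as ℕ
open import Data.Nat.DivMod using (_mod_; _%_; m%n<n; m<n⇒m%n≡m; n%n≡0)
open import Data.Product.Base using (Σ-syntax; ∃; _×_; _,_)
open import Data.Product.Properties using () renaming (≡-dec to ×-≡-dec)
open import Data.Sum.Base using (_⊎_; inj₁; inj₂; swap)
open import Data.Sum.Properties using (inj₁-injective; inj₂-injective) renaming (≡-dec to ⊎-≡-dec)
open import Level using (0ℓ)
open import Relation.Binary.Construct.Closure.ReflexiveTransitive using (Star; ε; _◅_; _◅◅_; reverse)
open import Relation.Binary.Core using (Rel)
open import Relation.Binary.Definitions using (Decidable; DecidableEquality; Symmetric)
open import Relation.Binary.PropositionalEquality using (_≡_; refl; sym; trans; cong; subst)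
open import Relation.Binary.Structures using (IsStrictTotalOrder)
import Relation.Binary.Construct.StrictToNonStrict as StrictToNonStrict
open import Relation.Nullary using (¬_; no; does)
open import Relation.Nullary.Decidable using (_⊎-dec_)

-- The library has no real numbers, so ℝ is taken axiomatically, as a
-- Dedekind-complete ordered field (unique up to isomorphism).
record CompleteOrderedField : Set₁ where
  infix  4 _<_
  infix  8 _⁻¹
  infixl 7 _/_

  field
    commutativeRing : CommutativeRing 0ℓ 0ℓ

  open CommutativeRing commutativeRing public
    using (Carrier; _≈_; _≉_; _+_; _*_; -_; _-_; 0#; 1#; +-rawMonoid)

  field
    -- The value 0# ⁻¹ is unspecified.
    _⁻¹        : Carrier → Carrier
    0≉1        : 0# ≉ 1#
    *-inverseʳ : ∀ x → x ≉ 0# → x * x ⁻¹ ≈ 1#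

    _<_ : Rel Carrier 0ℓ
    isStrictTotalOrder : IsStrictTotalOrder _≈_ _<_
    +-monoˡ-< : ∀ {x y} z → x < y → x + z < y + z
    *-pos     : ∀ {x y} → 0# < x → 0# < y → 0# < x * y

  open StrictToNonStrict _≈_ _<_ public using (_≤_)

  IsLowerBound : (Carrier → Set) → Carrier → Set
  IsLowerBound P b = ∀ x → P x → b ≤ x

  IsInfimum : (Carrier → Set) → Carrier → Set
  IsInfimum P m = IsLowerBound P m × (∀ b → IsLowerBound P b → b ≤ m)

  field
    -- inf P is unspecified when P is empty or unbounded below.
    inf           : (Carrier → Set) → Carrier
    inf-isInfimum : ∀ P → ∃ P → ∃ (IsLowerBound P) → IsInfimum P (inf P)

  _/_ : Carrier → Carrier → Carrier
  x / y = x * y ⁻¹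

  fromℕ : ℕ → Carrier
  fromℕ n = RawMonoid._×_ +-rawMonoid n 1#

  sumOver : {A : Set} → List A → (A → Carrier) → Carrier
  sumOver xs f = foldr (λ x s → f x + s) 0# xs

  -- The two inequalities say ∣ f α - l ∣ < e.
  HasLeftLimitAt1 : (Carrier → Carrier) → Carrier → Set
  HasLeftLimitAt1 f l =
    ∀ e → 0# < e → Σ[ δ ∈ Carrier ] (0# < δ ×
      (∀ α → 0# ≤ α → 1# - δ < α → α < 1# → (- e < f α - l) × (f α - l < e)))

-- Finite connected simple graphs; a walk from x to y is an element of Star _~_ x y.
record Graph : Set₁ where
  infix 4 _~_ _~?_ _≟_
  field
    Vertex    : Set
    _≟_       : DecidableEquality Vertex
    vertices  : List Vertex
    complete  : ∀ v → v ∈ vertices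
    unique    : Unique vertices
    _~_       : Rel Vertex 0ℓ
    _~?_      : Decidable _~_
    ~-sym     : Symmetric _~_
    ~-irrefl  : ∀ {x} → ¬ (x ~ x)
    connected : ∀ x y → Star _~_ x y

  degree : Vertex → ℕ
  degree x = length (filter (x ~?_) vertices)

module _ (ℝ : CompleteOrderedField) (G : Graph) where
  open CompleteOrderedField ℝ
  open Graph G

  -- Only the values of weight on adjacent pairs are meaningful.
  record Weighting : Set where
    field
      weight     : Vertex → Vertex → Carrier
      weight-sym : ∀ {x y} → x ~ y → weight x y ≈ weight y x
      weight-pos : ∀ {x y} → x ~ y → 0# < weight x y

-- The Lin–Lu–Yau curvature of a weighted graph.
module LinLuYau (ℝ : CompleteOrderedField) (G : Graph) (w : Weighting ℝ G) where
  open CompleteOrderedField ℝ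
  open Graph G
  open Weighting w

  pathWeight : ∀ {x y} → Star _~_ x y → Carrier
  pathWeight ε = 0#
  pathWeight (_◅_ {x} {y} _ p) = weight x y + pathWeight p

  -- All walks are allowed: deleting a closed part never increases the weight,
  -- so the least weight is the same as over simple paths.
  dist : Vertex → Vertex → Carrier
  dist x y = inf (λ r → Σ[ p ∈ Star _~_ x y ] r ≈ pathWeight p)

  μ : Carrier → Vertex → Vertex → Carrier
  μ α x v =
    if does (v ≟ x) then α
    else if does (x ~? v) then (1# - α) / fromℕ (degree x)
    else 0#

  record IsCoupling (π : Vertex → Vertex → Carrier) (μ₁ μ₂ : Vertex → Carrier) : Set where
    field
      nonneg    : ∀ u v → 0# ≤ π u v
      marginal₁ : ∀ u → sumOver vertices (λ v → π u v) ≈ μ₁ u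
      marginal₂ : ∀ v → sumOver vertices (λ u → π u v) ≈ μ₂ v

  cost : (Vertex → Vertex → Carrier) → Carrier
  cost π = sumOver vertices (λ u → sumOver vertices (λ v → π u v * dist u v))

  wasserstein : (μ₁ μ₂ : Vertex → Carrier) → Carrier
  wasserstein μ₁ μ₂ =
    inf (λ r → Σ[ π ∈ (Vertex → Vertex → Carrier) ] (IsCoupling π μ₁ μ₂ × r ≈ cost π))

  κα : Carrier → Vertex → Vertex → Carrier
  κα α x y = 1# - wasserstein (μ α x) (μ α y) / dist x y

  HasCurvature : Vertex → Vertex → Carrier → Set
  HasCurvature x y κ = HasLeftLimitAt1 (λ α → κα α x y / (1# - α)) κ

  IsEinstein : Set
  IsEinstein = Σ[ κ ∈ Carrier ] (∀ x y → x ~ y → HasCurvature x y κ)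

next : ∀ {n} → Fin n → Fin n
next {suc n} i = suc (toℕ i) mod suc n

-- The cycle C_g with d ∸ 2 pendant leaves at each cycle vertex.
module Sun (g d : ℕ) where

  SunVertex : Set
  SunVertex = Fin g ⊎ (Fin g × Fin (d ∸ 2))

  pattern cyc i    = inj₁ i
  pattern leaf i k = inj₂ (i , k)

  Adjacent : Rel SunVertex 0ℓ
  Adjacent (cyc i)    (cyc j)    = j ≡ next i ⊎ i ≡ next j
  Adjacent (cyc i)    (leaf j _) = i ≡ j
  Adjacent (leaf i _) (cyc j)    = i ≡ j
  Adjacent (leaf _ _) (leaf _ _) = ⊥

  adjacent? : Decidable Adjacent
  adjacent? (cyc i)    (cyc j)    = (j ≟ᶠ next i) ⊎-dec (i ≟ᶠ next j)
  adjacent? (cyc i)    (leaf j _) = i ≟ᶠ j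
  adjacent? (leaf i _) (cyc j)    = i ≟ᶠ j
  adjacent? (leaf _ _) (leaf _ _) = no (λ ())

  adjacent-sym : Symmetric Adjacent
  adjacent-sym {cyc _}    {cyc _}    = swap
  adjacent-sym {cyc _}    {leaf _ _} = sym
  adjacent-sym {leaf _ _} {cyc _}    = sym

  sunVertices : List SunVertex
  sunVertices = map inj₁ (allFin g) ++ map inj₂ (cartesianProduct (allFin g) (allFin (d ∸ 2)))

  sunVertices-complete : ∀ v → v ∈ sunVertices
  sunVertices-complete (cyc i)    = ∈-++⁺ˡ (∈-map⁺ inj₁ (∈-allFin i))
  sunVertices-complete (leaf i k) =
    ∈-++⁺ʳ (map inj₁ (allFin g)) (∈-map⁺ inj₂ (∈-cartesianProduct⁺ (∈-allFin i) (∈-allFin k)))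

  sunVertices-unique : Unique sunVertices
  sunVertices-unique = Unique.++⁺
    (Unique.map⁺ inj₁-injective (Unique.allFin⁺ g))
    (Unique.map⁺ inj₂-injective (Unique.cartesianProduct⁺ (Unique.allFin⁺ g) (Unique.allFin⁺ (d ∸ 2))))
    disjoint
    where
    disjoint : ∀ {v} → ¬ (v ∈ map inj₁ (allFin g) ×
                          v ∈ map inj₂ (cartesianProduct (allFin g) (allFin (d ∸ 2))))
    disjoint (p , q) with ∈-map⁻ inj₁ p | ∈-map⁻ inj₂ q
    ... | _ , _ , refl | _ , _ , ()

toℕ-next : ∀ {n} (i : Fin (suc n)) → toℕ (next i) ≡ suc (toℕ i) % suc n
toℕ-next {n} i = toℕ-fromℕ< (m%n<n (suc (toℕ i)) (suc n))

next≢id : ∀ {n} → 2 ℕ.≤ n → (i : Fin n) → ¬ (i ≡ next i)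
next≢id {suc n} 2≤n i i≡next with ℕ.m≤n⇒m<n∨m≡n (toℕ<n i)
... | inj₁ lt =
  ℕ.1+n≢n (sym (trans (cong toℕ i≡next) (trans (toℕ-next i) (m<n⇒m%n≡m lt))))
... | inj₂ eq = ℕ.<-irrefl {1} refl (subst (2 ℕ.≤_) (trans (sym eq) (cong suc i≡0)) 2≤n)
  where
  i≡0 : toℕ i ≡ 0
  i≡0 = trans (cong toℕ i≡next)
    (trans (toℕ-next i) (trans (cong (_% suc n) eq) (n%n≡0 (suc n))))

module _ (g d : ℕ) (3≤g : 3 ℕ.≤ g) where
  open Sun g d

  private
    adjacent-irrefl : ∀ {x} → ¬ Adjacent x x
    adjacent-irrefl {cyc i} (inj₁ e) = next≢id (ℕ.≤-trans (s≤s (s≤s z≤n)) 3≤g) i e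
    adjacent-irrefl {cyc i} (inj₂ e) = next≢id (ℕ.≤-trans (s≤s (s≤s z≤n)) 3≤g) i e
    adjacent-irrefl {leaf _ _} ()

    0<g : 0 ℕ.< g
    0<g = ℕ.≤-trans (s≤s z≤n) 3≤g

    next-fromℕ< : ∀ {n k} (k<n : k ℕ.< n) (1+k<n : suc k ℕ.< n) →
                  fromℕ< 1+k<n ≡ next (fromℕ< k<n)
    next-fromℕ< {suc n} k<n 1+k<n = toℕ-injective
      (trans (toℕ-fromℕ< 1+k<n)
        (sym (trans (toℕ-next (fromℕ< k<n))
          (trans (cong (λ m → suc m % suc n) (toℕ-fromℕ< k<n)) (m<n⇒m%n≡m 1+k<n)))))

    toCycle : ∀ k (k<g : k ℕ.< g) → Star Adjacent (cyc (fromℕ< 0<g)) (cyc (fromℕ< k<g))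
    toCycle zero    k<g rewrite ℕ.<-irrelevant k<g 0<g = ε
    toCycle (suc k) k<g =
      toCycle k k′<g ◅◅ (inj₁ (next-fromℕ< k′<g k<g) ◅ ε)
      where
      k′<g : k ℕ.< g
      k′<g = ℕ.<-trans (ℕ.n<1+n k) k<g

    fromBase : ∀ v → Star Adjacent (cyc (fromℕ< 0<g)) v
    fromBase (cyc i)    =
      subst (λ j → Star Adjacent (cyc (fromℕ< 0<g)) (cyc j)) (fromℕ<-toℕ i (toℕ<n i)) (toCycle (toℕ i) (toℕ<n i))
    fromBase (leaf i k) = fromBase (cyc i) ◅◅ (refl ◅ ε)

  sunGraph : Graph
  sunGraph = record
    { Vertex    = SunVertex
    ; _≟_       = ⊎-≡-dec _≟ᶠ_ (×-≡-dec _≟ᶠ_ _≟ᶠ_)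
    ; vertices  = sunVertices
    ; complete  = sunVertices-complete
    ; unique    = sunVertices-unique
    ; _~_       = Adjacent
    ; _~?_      = adjacent?
    ; ~-sym     = λ {x} {y} → adjacent-sym {x} {y}
    ; ~-irrefl  = λ {x} → adjacent-irrefl {x}
    ; connected = λ x y → reverse (λ {a} {b} → adjacent-sym {a} {b}) (fromBase x) ◅◅ fromBase y
    }

module CycleEdges (ℝ : CompleteOrderedField) (g d : ℕ) (3≤g : 3 ℕ.≤ g)
                  (w : Weighting ℝ (sunGraph g d 3≤g)) where
  open CompleteOrderedField ℝ
  open Weighting w

  -- Weight of the cycle edge joining i and next i; as g ≥ 3, every cycle
  -- edge arises from exactly one i.
  cycleWeight : Fin g → Carrier
  cycleWeight i = weight (inj₁ i) (inj₁ (next i))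

  cycleLength : Carrier
  cycleLength = sumOver (allFin g) cycleWeight

  HasNonGeodesicCycleEdge : Set
  HasNonGeodesicCycleEdge = Σ[ i ∈ Fin g ] (1# / fromℕ 2 * cycleLength < cycleWeight i)

{-# OPTIONS --safe #-}
module Submission where

-- Let (i₀ , next i₀) be the non-geodesic cycle edge, of weight W and with cycle length L ≤ 2 W.
-- Then no geodesic uses this edge, and there is a 1-Lipschitz height function f on the cycle whose
-- drop f j - f (next j) is the weight of the edge j for j ≠ i₀, and - (L - W) for j = i₀.
-- Extending f to the leaves (upwards at j, downwards at next j) and using it as a Kantorovich
-- potential bounds the curvature of each edge j ≠ i₀ from above, while an explicit transport plan
-- bounds the curvature of the edge i₀ from below.  Summed over the cycle, the drops cancel; what
-- remains is that minus twice the total weight of the leaves not hanging at i₀ or next i₀ is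
-- nonnegative, which is absurd since g ≥ 3 and d ≥ 3.

-- One edge needs a different method because of a sign. A potential bounds the curvature of an edge
-- only from above, and multiplying such a bound by `drop j` keeps its direction only if the drop is
-- positive. At `i₀` the drop is negative, so an upper bound on `κ * (deg * drop i₀)` requires a
-- lower bound on `κ`, hence an explicit plan. All `g` inequalities then have the left-hand side
-- `κ * (deg * drop j)`, and as the drops add up to zero, `κ` disappears from the sum whatever its
-- sign.
--
-- The factor two in the remainder arises as follows. The potential gains the leaf weights at both
-- ends of its edge, so each cycle vertex is charged for its leaves once for each of its two cycle
-- edges. At `i₀` the plan moves leaf to leaf and has to pay those weights instead of gaining them,
-- which gives back twice the leaf weight at `i₀` and `next i₀`. The remaining vertices make the
-- total strictly negative.

open import Defs
open import Algebra.Bundles using (CommutativeRing)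
import Algebra.Properties.AbelianGroup as AbelianGroupProperties
import Algebra.Properties.Ring as RingProperties
import Algebra.Properties.Semiring.Mult.TCOptimised as SemiringMult
import Algebra.Solver.Ring as RingSolver
open import Algebra.Solver.Ring.AlmostCommutativeRing using (fromCommutativeRing; _-Raw-AlmostCommutative⟶_)
open import Data.Bool.Base using (Bool; true; false; if_then_else_)
open import Data.Fin.Base using (Fin; toℕ; fromℕ<)
open import Data.Fin.Properties using (toℕ<n; toℕ-injective) renaming (_≟_ to _≟ᶠ_)
open import Data.Integer.Base as ℤ using (ℤ; +_; -[1+_]; _⊖_)
import Data.Integer.Properties as ℤ
open import Data.List.Base using (List; []; _∷_; map; allFin; filter; length)
open import Data.List.Membership.Propositional using (_∈_)
open import Data.List.Membership.Propositional.Properties using (∈-allFin)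
open import Data.List.Relation.Unary.All as All using (All)
open import Data.List.Relation.Unary.All.Properties using () renaming (map⁺ to All-map⁺)
open import Data.List.Relation.Unary.AllPairs using (_∷_)
open import Data.List.Relation.Unary.Any using (here; there)
open import Data.List.Relation.Unary.Unique.Propositional using (Unique)
import Data.List.Relation.Unary.Unique.Propositional.Properties as Unique
open import Data.Maybe.Base using (Maybe; just; nothing)
open import Data.Nat.Base as ℕ using (ℕ; zero; suc)
open import Data.Nat.DivMod using (_%_; %-distribˡ-+; m%n%n≡m%n; m<n⇒m%n≡m; [m+n]%n≡m%n; n%n≡0)
import Data.Nat.Properties as ℕ
open import Data.Product.Base using (Σ-syntax; _×_; _,_; proj₁; proj₂)
open import Data.Sum.Base using (inj₁; inj₂)
open import Data.Sum.Properties using (inj₁-injective)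
open import Level using (0ℓ)
open import Relation.Binary.Construct.Closure.ReflexiveTransitive using (Star; ε; _◅_; _◅◅_)
import Relation.Binary.Construct.StrictToNonStrict as StrictToNonStrict
open import Relation.Binary.Definitions using (DecidableEquality; tri<; tri≈; tri>)
open import Relation.Binary.PropositionalEquality as ≡ using (_≡_; _≢_)
open import Relation.Binary.Structures using (IsStrictTotalOrder)
open import Relation.Nullary using (¬_; Dec; yes; no; does; contradiction)

-- Ring solver with integer coefficients for an arbitrary commutative ring.

module IntegerSolver (R : CommutativeRing 0ℓ 0ℓ) where
  open CommutativeRing R
  open RingProperties ring using (-‿distribˡ-*; -‿distribʳ-*)
  open AbelianGroupProperties +-abelianGroup using (ε⁻¹≈ε; ⁻¹-∙-comm; ⁻¹-involutive)
  open SemiringMult semiring using (1+×; ×-homo-+; ×1-homo-*) renaming (_×_ to _·_)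
  open import Relation.Binary.Reasoning.Setoid setoid

  -- With the optimised multiple, `1 · 1#` is `1#` by computation, so `con (+ 1)` in solver
  -- equations denotes exactly `1#`.
  ⟦_⟧ℤ : ℤ → Carrier
  ⟦ + n ⟧ℤ      = n · 1#
  ⟦ -[1+ n ] ⟧ℤ = - (suc n · 1#)

  ≡⇒≈ : ∀ {i j} → i ≡ j → ⟦ i ⟧ℤ ≈ ⟦ j ⟧ℤ
  ≡⇒≈ ≡.refl = refl

  ⟦⟧-neg : ∀ i → ⟦ ℤ.- i ⟧ℤ ≈ - ⟦ i ⟧ℤ
  ⟦⟧-neg (+ zero)  = sym ε⁻¹≈ε
  ⟦⟧-neg (+ suc n) = refl
  ⟦⟧-neg -[1+ n ]  = sym (⁻¹-involutive _)

  ⟦⟧-⊖ : ∀ m n → ⟦ m ⊖ n ⟧ℤ ≈ m · 1# - n · 1#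
  ⟦⟧-⊖ m zero          = sym (trans (+-congˡ ε⁻¹≈ε) (+-identityʳ _))
  ⟦⟧-⊖ zero (suc n)    = sym (+-identityˡ _)
  ⟦⟧-⊖ (suc m) (suc n) = begin
    ⟦ suc m ⊖ suc n ⟧ℤ                  ≈⟨ ≡⇒≈ (ℤ.[1+m]⊖[1+n]≡m⊖n m n) ⟩
    ⟦ m ⊖ n ⟧ℤ                          ≈⟨ ⟦⟧-⊖ m n ⟩
    m · 1# - n · 1#                     ≈⟨ +-identityˡ _ ⟨
    0# + (m · 1# - n · 1#)              ≈⟨ +-congʳ (-‿inverseʳ 1#) ⟨
    (1# - 1#) + (m · 1# - n · 1#)       ≈⟨ +-assoc _ _ _ ⟩
    1# + (- 1# + (m · 1# - n · 1#))     ≈⟨ +-congˡ (trans (sym (+-assoc _ _ _)) (trans (+-congʳ (+-comm _ _)) (+-assoc _ _ _))) ⟩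
    1# + (m · 1# + (- 1# - n · 1#))     ≈⟨ +-assoc _ _ _ ⟨
    (1# + m · 1#) + (- 1# - n · 1#)     ≈⟨ +-congˡ (⁻¹-∙-comm _ _) ⟩
    (1# + m · 1#) - (1# + n · 1#)       ≈⟨ +-cong (1+× m 1#) (-‿cong (1+× n 1#)) ⟨
    suc m · 1# - suc n · 1#             ∎

  ⟦⟧-+ : ∀ i j → ⟦ i ℤ.+ j ⟧ℤ ≈ ⟦ i ⟧ℤ + ⟦ j ⟧ℤ
  ⟦⟧-+ (+ m)    (+ n)    = ×-homo-+ 1# m n
  ⟦⟧-+ (+ m)    -[1+ n ] = ⟦⟧-⊖ m (suc n)
  ⟦⟧-+ -[1+ m ] (+ n)    = trans (⟦⟧-⊖ n (suc m)) (+-comm _ _)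
  ⟦⟧-+ -[1+ m ] -[1+ n ] = begin
    - (suc (suc (m ℕ.+ n)) · 1#)        ≡⟨ ≡.cong (λ k → - (suc k · 1#)) (ℕ.+-suc m n) ⟨
    - ((suc m ℕ.+ suc n) · 1#)          ≈⟨ -‿cong (×-homo-+ 1# (suc m) (suc n)) ⟩
    - (suc m · 1# + suc n · 1#)         ≈⟨ ⁻¹-∙-comm _ _ ⟨
    - (suc m · 1#) - suc n · 1#         ∎

  ⟦⟧-* : ∀ i j → ⟦ i ℤ.* j ⟧ℤ ≈ ⟦ i ⟧ℤ * ⟦ j ⟧ℤ
  ⟦⟧-*+ : ∀ i n → ⟦ i ℤ.* + n ⟧ℤ ≈ ⟦ i ⟧ℤ * ⟦ + n ⟧ℤ
  ⟦⟧-*+ (+ m)    n = trans (≡⇒≈ (≡.sym (ℤ.pos-* m n))) (×1-homo-* m n)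
  ⟦⟧-*+ -[1+ m ] n = begin
    ⟦ -[1+ m ] ℤ.* + n ⟧ℤ         ≈⟨ ≡⇒≈ (ℤ.neg-distribˡ-* (+ suc m) (+ n)) ⟨
    ⟦ ℤ.- (+ suc m ℤ.* + n) ⟧ℤ    ≈⟨ ⟦⟧-neg (+ suc m ℤ.* + n) ⟩
    - ⟦ + suc m ℤ.* + n ⟧ℤ        ≈⟨ -‿cong (⟦⟧-*+ (+ suc m) n) ⟩
    - (suc m · 1# * ⟦ + n ⟧ℤ)     ≈⟨ -‿distribˡ-* _ _ ⟩
    - (suc m · 1#) * ⟦ + n ⟧ℤ     ∎
  ⟦⟧-* i (+ n)    = ⟦⟧-*+ i n
  ⟦⟧-* i -[1+ n ] = begin
    ⟦ i ℤ.* -[1+ n ] ⟧ℤ           ≈⟨ ≡⇒≈ (ℤ.neg-distribʳ-* i (+ suc n)) ⟨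
    ⟦ ℤ.- (i ℤ.* + suc n) ⟧ℤ      ≈⟨ ⟦⟧-neg (i ℤ.* + suc n) ⟩
    - ⟦ i ℤ.* + suc n ⟧ℤ          ≈⟨ -‿cong (⟦⟧-*+ i (suc n)) ⟩
    - (⟦ i ⟧ℤ * suc n · 1#)       ≈⟨ -‿distribʳ-* _ _ ⟩
    ⟦ i ⟧ℤ * - (suc n · 1#)       ∎

  morphism : ℤ.+-*-rawRing -Raw-AlmostCommutative⟶ fromCommutativeRing R
  morphism = record
    { ⟦_⟧    = ⟦_⟧ℤ
    ; +-homo = ⟦⟧-+
    ; *-homo = ⟦⟧-*
    ; -‿homo = ⟦⟧-neg
    ; 0-homo = refl
    ; 1-homo = refl
    }

  ⟦⟧-≟ : ∀ i j → Maybe (⟦ i ⟧ℤ ≈ ⟦ j ⟧ℤ)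
  ⟦⟧-≟ i j with i ℤ.≟ j
  ... | yes i≡j = just (≡⇒≈ i≡j)
  ... | no  _   = nothing

  open RingSolver ℤ.+-*-rawRing (fromCommutativeRing R) morphism ⟦⟧-≟ public
    using (solve; _:=_; con; _:+_; _:*_; :-_; _:-_)

-- Order and inverse arithmetic.

module OrderedField (ℝ : CompleteOrderedField) where
  open CompleteOrderedField ℝ public
  open CommutativeRing commutativeRing public
    using (refl; sym; trans; setoid; +-cong; +-congˡ; +-congʳ; *-cong; *-congˡ; *-congʳ; -‿cong; *-comm;
           +-identityˡ; +-identityʳ; *-identityˡ; zeroʳ; zeroˡ; distribˡ; reflexive)
  open IntegerSolver commutativeRing public
    using (solve; _:=_; con; _:+_; _:*_; :-_; _:-_)
  open IsStrictTotalOrder isStrictTotalOrder public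
    using (compare; isEquivalence; <-resp-≈)
    renaming (irrefl to <-irrefl; trans to <-trans)
  private module S = StrictToNonStrict _≈_ _<_

  ≤-refl : ∀ {x} → x ≤ x
  ≤-refl = inj₂ refl

  ≤-trans : ∀ {x y z} → x ≤ y → y ≤ z → x ≤ z
  ≤-trans = S.trans isEquivalence <-resp-≈ <-trans

  ≤-antisym : ∀ {x y} → x ≤ y → y ≤ x → x ≈ y
  ≤-antisym = S.antisym isEquivalence <-trans <-irrefl

  ≤-resp : ∀ {x x′ y y′} → x ≈ x′ → y ≈ y′ → x ≤ y → x′ ≤ y′
  ≤-resp p q r = ≤-trans (inj₂ (sym p)) (≤-trans r (inj₂ q))

  <-resp : ∀ {x x′ y y′} → x ≈ x′ → y ≈ y′ → x < y → x′ < y′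
  <-resp p q r = proj₁ <-resp-≈ q (proj₂ <-resp-≈ p r)

  <-≤-trans : ∀ {x y z} → x < y → y ≤ z → x < z
  <-≤-trans p (inj₁ q) = <-trans p q
  <-≤-trans p (inj₂ q) = <-resp refl q p

  ≤⇒≯ : ∀ {x y} → x ≤ y → ¬ (y < x)
  ≤⇒≯ p q = <-irrefl refl (<-≤-trans q p)

  ≮⇒≥ : ∀ {x y} → ¬ (x < y) → y ≤ x
  ≮⇒≥ {x} {y} x≮y with compare x y
  ... | tri< x<y _ _ = contradiction x<y x≮y
  ... | tri≈ _ x≈y _ = inj₂ (sym x≈y)
  ... | tri> _ _ y<x = inj₁ y<x

  x<y⇒0<y-x : ∀ {x y} → x < y → 0# < y - x
  x<y⇒0<y-x {x} {y} p =
    <-resp (solve 1 (λ x → x :- x := con (+ 0)) refl x) refl (+-monoˡ-< (- x) p)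

  0<y-x⇒x<y : ∀ {x y} → 0# < y - x → x < y
  0<y-x⇒x<y {x} {y} p =
    <-resp (+-identityˡ x) (solve 2 (λ x y → y :- x :+ x := y) refl x y) (+-monoˡ-< x p)

  x≤y⇒0≤y-x : ∀ {x y} → x ≤ y → 0# ≤ y - x
  x≤y⇒0≤y-x (inj₁ p) = inj₁ (x<y⇒0<y-x p)
  x≤y⇒0≤y-x {x} {y} (inj₂ p) =
    inj₂ (trans (solve 1 (λ x → con (+ 0) := x :- x) refl x) (+-congʳ p))

  0≤y-x⇒x≤y : ∀ {x y} → 0# ≤ y - x → x ≤ y
  0≤y-x⇒x≤y (inj₁ p) = inj₁ (0<y-x⇒x<y p)
  0≤y-x⇒x≤y {x} {y} (inj₂ p) =
    inj₂ (trans (sym (+-identityˡ x)) (trans (+-congʳ p) (solve 2 (λ x y → y :- x :+ x := y) refl x y)))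

  0≤+ : ∀ {x y} → 0# ≤ x → 0# ≤ y → 0# ≤ x + y
  0<+ : ∀ {x y} → 0# < x → 0# ≤ y → 0# < x + y
  0<+ {x} {y} p q = <-≤-trans p (0≤y-x⇒x≤y (≤-resp refl (solve 2 (λ x y → y := x :+ y :- x) refl x y) q))
  0≤+ (inj₁ p) q = inj₁ (0<+ p q)
  0≤+ (inj₂ p) q = ≤-trans q (inj₂ (trans (sym (+-identityˡ _)) (+-congʳ p)))

  0≤* : ∀ {x y} → 0# ≤ x → 0# ≤ y → 0# ≤ x * y
  0≤* (inj₁ p) (inj₁ q) = inj₁ (*-pos p q)
  0≤* (inj₂ p) _        = inj₂ (trans (sym (zeroˡ _)) (*-congʳ p))
  0≤* (inj₁ _) (inj₂ q) = inj₂ (trans (sym (zeroʳ _)) (*-congˡ q))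

  +-mono-≤ : ∀ {a b c d} → a ≤ b → c ≤ d → a + c ≤ b + d
  +-mono-≤ {a} {b} {c} {d} p q = 0≤y-x⇒x≤y (≤-resp refl
    (solve 4 (λ a b c d → (b :- a) :+ (d :- c) := b :+ d :- (a :+ c)) refl a b c d)
    (0≤+ (x≤y⇒0≤y-x p) (x≤y⇒0≤y-x q)))

  *-monoˡ-≤ : ∀ {a b c} → 0# ≤ a → b ≤ c → a * b ≤ a * c
  *-monoˡ-≤ {a} {b} {c} p q = 0≤y-x⇒x≤y (≤-resp refl
    (solve 3 (λ a b c → a :* (c :- b) := a :* c :- a :* b) refl a b c)
    (0≤* p (x≤y⇒0≤y-x q)))

  neg-mono-≤ : ∀ {a b} → a ≤ b → - b ≤ - a
  neg-mono-≤ {a} {b} p = 0≤y-x⇒x≤y (≤-resp refl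
    (solve 2 (λ a b → b :- a := :- a :- :- b) refl a b) (x≤y⇒0≤y-x p))

  0<1 : 0# < 1#
  0<1 with compare 0# 1#
  ... | tri< p _ _ = p
  ... | tri≈ _ p _ = contradiction p 0≉1
  ... | tri> _ _ p = <-resp refl
    (solve 0 ((con (+ 0) :- con (+ 1)) :* (con (+ 0) :- con (+ 1)) := con (+ 1)) refl)
    (*-pos (x<y⇒0<y-x p) (x<y⇒0<y-x p))

  pos⇒≉0 : ∀ {x} → 0# < x → x ≉ 0#
  pos⇒≉0 p q = <-irrefl (sym q) p

  *-cancelˡ-≤ : ∀ {a b c} → 0# < a → a * b ≤ a * c → b ≤ c
  *-cancelˡ-≤ {a} {b} {c} 0<a p = ≮⇒≥ λ c<b → ≤⇒≯ p (0<y-x⇒x<y (<-resp refl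
    (solve 3 (λ a b c → a :* (b :- c) := a :* b :- a :* c) refl a b c)
    (*-pos 0<a (x<y⇒0<y-x c<b))))

  *-inverse : ∀ {x} → 0# < x → x * x ⁻¹ ≈ 1#
  *-inverse p = *-inverseʳ _ (pos⇒≉0 p)

  ⁻¹-pos : ∀ {x} → 0# < x → 0# < x ⁻¹
  ⁻¹-pos {x} 0<x with compare 0# (x ⁻¹)
  ... | tri< p _ _ = p
  ... | tri≈ _ p _ = contradiction (trans (sym (zeroʳ x)) (trans (*-congˡ p) (*-inverse 0<x))) 0≉1
  ... | tri> _ _ p = contradiction 0<1 (≤⇒≯ (inj₁ (0<y-x⇒x<y (<-resp refl
    (trans (solve 2 (λ x y → x :* (con (+ 0) :- y) := con (+ 0) :- x :* y) refl x (x ⁻¹))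
           (+-congˡ (-‿cong (*-inverse 0<x))))
    (*-pos 0<x (x<y⇒0<y-x p))))))

  -- _⁻¹ is not assumed to respect _≈_.
  ⁻¹-cong : ∀ {x y} → 0# < x → x ≈ y → x ⁻¹ ≈ y ⁻¹
  ⁻¹-cong {x} {y} 0<x x≈y = trans (sym (trans (*-congˡ (*-inverse (<-resp refl x≈y 0<x))) (trans (*-comm _ _) (*-identityˡ _))))
    (trans (solve 3 (λ i y j → i :* (y :* j) := y :* i :* j) refl (x ⁻¹) y (y ⁻¹))
      (trans (*-congʳ (trans (*-congʳ (sym x≈y)) (*-inverse 0<x))) (*-identityˡ _)))

  ½ : Carrier
  ½ = (1# + 1#) ⁻¹

  0<2 : 0# < 1# + 1#
  0<2 = 0<+ 0<1 (inj₁ 0<1)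

  0<½ : 0# < ½
  0<½ = ⁻¹-pos 0<2

  ½+½ : ∀ x → ½ * x + ½ * x ≈ x
  ½+½ x = trans (solve 2 (λ h x → h :* x :+ h :* x := (con (+ 1) :+ con (+ 1)) :* h :* x) refl ½ x)
    (trans (*-congʳ (*-inverse 0<2)) (*-identityˡ x))

  halve : ∀ {x} → 0# < x → 0# < ½ * x × ½ * x < x
  halve {x} 0<x = 0<h , 0<y-x⇒x<y (<-resp refl
    (trans (solve 1 (λ h → h := h :+ h :- h) refl (½ * x)) (+-congʳ (½+½ x))) 0<h)
    where
    0<h : 0# < ½ * x
    0<h = *-pos 0<½ 0<x

  between : ∀ {a b} → 0# < a → 0# < b → Σ[ c ∈ Carrier ] (0# < c × c < a × c < b)
  between {a} {b} 0<a 0<b with compare a b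
  ... | tri< p _ _ = ½ * a , proj₁ (halve 0<a) , proj₂ (halve 0<a) , <-trans (proj₂ (halve 0<a)) p
  ... | tri≈ _ p _ = ½ * a , proj₁ (halve 0<a) , proj₂ (halve 0<a) , <-resp refl p (proj₂ (halve 0<a))
  ... | tri> _ _ p = ½ * b , proj₁ (halve 0<b) , <-trans (proj₂ (halve 0<b)) p , proj₂ (halve 0<b)

-- Finite sums, indicators and Kronecker deltas.

module Sums (ℝ : CompleteOrderedField) where
  open OrderedField ℝ

  private variable A B : Set

  sumOver-cong : ∀ (xs : List A) {f h : A → Carrier} → (∀ x → f x ≈ h x) → sumOver xs f ≈ sumOver xs h
  sumOver-cong []       p = refl
  sumOver-cong (x ∷ xs) p = +-cong (p x) (sumOver-cong xs p)

  sumOver-+ : ∀ (xs : List A) (f h : A → Carrier) →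
              sumOver xs (λ x → f x + h x) ≈ sumOver xs f + sumOver xs h
  sumOver-+ []       f h = sym (+-identityˡ 0#)
  sumOver-+ (x ∷ xs) f h = trans (+-congˡ (sumOver-+ xs f h))
    (solve 4 (λ a b c d → a :+ b :+ (c :+ d) := a :+ c :+ (b :+ d)) refl _ _ _ _)

  sumOver-*ˡ : ∀ (xs : List A) c (f : A → Carrier) → sumOver xs (λ x → c * f x) ≈ c * sumOver xs f
  sumOver-*ˡ []       c f = sym (zeroʳ c)
  sumOver-*ˡ (x ∷ xs) c f = trans (+-congˡ (sumOver-*ˡ xs c f)) (sym (distribˡ c _ _))

  sumOver-- : ∀ (xs : List A) (f h : A → Carrier) →
              sumOver xs (λ x → f x - h x) ≈ sumOver xs f - sumOver xs h
  sumOver-- []       f h = solve 0 (con (+ 0) := con (+ 0) :- con (+ 0)) refl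
  sumOver-- (x ∷ xs) f h = trans (+-congˡ (sumOver-- xs f h))
    (solve 4 (λ a b c d → a :- b :+ (c :- d) := a :+ c :- (b :+ d)) refl _ _ _ _)

  sumOver-0 : ∀ (xs : List A) → sumOver xs (λ _ → 0#) ≈ 0#
  sumOver-0 []       = refl
  sumOver-0 (x ∷ xs) = trans (+-identityˡ _) (sumOver-0 xs)

  sumOver-comm : ∀ (xs : List A) (ys : List B) (f : A → B → Carrier) →
                 sumOver xs (λ x → sumOver ys (f x)) ≈ sumOver ys (λ y → sumOver xs (λ x → f x y))
  sumOver-comm []       ys f = sym (sumOver-0 ys)
  sumOver-comm (x ∷ xs) ys f =
    trans (+-congˡ (sumOver-comm xs ys f)) (sym (sumOver-+ ys (f x) (λ y → sumOver xs (λ x → f x y))))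

  sumOver-map : ∀ (xs : List A) (h : A → B) (f : B → Carrier) →
                sumOver (map h xs) f ≡ sumOver xs (λ x → f (h x))
  sumOver-map []       h f = ≡.refl
  sumOver-map (x ∷ xs) h f = ≡.cong (_+_ (f (h x))) (sumOver-map xs h f)

  sumOver-const : ∀ (xs : List A) c → sumOver xs (λ _ → c) ≈ c * sumOver xs (λ _ → 1#)
  sumOver-const xs c = trans (sumOver-cong xs (λ _ → solve 1 (λ c → c := c :* con (+ 1)) refl c))
    (sumOver-*ˡ xs c (λ _ → 1#))

  sumOver-mono : ∀ (xs : List A) {f h : A → Carrier} → (∀ x → f x ≤ h x) → sumOver xs f ≤ sumOver xs h
  sumOver-mono []       p = ≤-refl
  sumOver-mono (x ∷ xs) p = +-mono-≤ (p x) (sumOver-mono xs p)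

  sumOver-nonneg : ∀ (xs : List A) {f : A → Carrier} → (∀ x → 0# ≤ f x) → 0# ≤ sumOver xs f
  sumOver-nonneg xs p = ≤-trans (inj₂ (sym (sumOver-0 xs))) (sumOver-mono xs p)

  sumOver-pos : ∀ {xs : List A} {x} {f : A → Carrier} →
                (∀ x → 0# ≤ f x) → x ∈ xs → 0# < f x → 0# < sumOver xs f
  sumOver-pos {xs = _ ∷ xs} p (here ≡.refl) q = 0<+ q (sumOver-nonneg xs p)
  sumOver-pos {xs = y ∷ xs} {f = f} p (there m) q =
    <-resp refl (solve 2 (λ a b → a :+ b := b :+ a) refl _ _) (0<+ (sumOver-pos {f = f} p m q) (p y))

  indicator : Bool → Carrier
  indicator b = if b then 1# else 0#

  indicator-nonneg : ∀ b → 0# ≤ indicator b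
  indicator-nonneg true  = inj₁ 0<1
  indicator-nonneg false = ≤-refl

  indicator-yes : ∀ {P : Set} (P? : Dec P) → P → indicator (does P?) ≡ 1#
  indicator-yes (yes _) _ = ≡.refl
  indicator-yes (no ¬p) p = contradiction p ¬p

  indicator-no : ∀ {P : Set} (P? : Dec P) → ¬ P → indicator (does P?) ≡ 0#
  indicator-no (yes p) ¬p = contradiction p ¬p
  indicator-no (no _)  _  = ≡.refl

  fromℕ-length-filter : {P : A → Set} (P? : ∀ x → Dec (P x)) (xs : List A) →
                        fromℕ (length (filter P? xs)) ≈ sumOver xs (λ x → indicator (does (P? x)))
  fromℕ-length-filter P? []       = refl
  fromℕ-length-filter P? (x ∷ xs) with does (P? x)
  ... | true  = +-congˡ (fromℕ-length-filter P? xs)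
  ... | false = trans (fromℕ-length-filter P? xs) (sym (+-identityˡ _))

  module Delta (_≟_ : DecidableEquality A) where

    δ : A → A → Carrier
    δ a v = indicator (does (v ≟ a))

    δ-refl : ∀ a → δ a a ≡ 1#
    δ-refl a = indicator-yes (a ≟ a) ≡.refl

    δ-≢ : ∀ {a v} → v ≢ a → δ a v ≡ 0#
    δ-≢ {a} {v} = indicator-no (v ≟ a)

    sumOver-δ-∉ : ∀ {xs a} (f : A → Carrier) → All (a ≢_) xs → sumOver xs (λ v → f v * δ a v) ≈ 0#
    sumOver-δ-∉ f All.[]      = refl
    sumOver-δ-∉ f (p All.∷ ps) = trans
      (+-cong (trans (*-congˡ (reflexive (δ-≢ λ v≡a → p (≡.sym v≡a)))) (zeroʳ _)) (sumOver-δ-∉ f ps))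
      (+-identityˡ 0#)

    sumOver-δ : ∀ {xs a} (f : A → Carrier) → Unique xs → a ∈ xs → sumOver xs (λ v → f v * δ a v) ≈ f a
    sumOver-δ {a = a} f (p ∷ _) (here ≡.refl) = trans
      (+-cong (*-congˡ (reflexive (δ-refl a))) (sumOver-δ-∉ f p))
      (solve 1 (λ x → x :* con (+ 1) :+ con (+ 0) := x) refl (f a))
    sumOver-δ {xs = y ∷ _} {a} f (p ∷ u) (there m) = trans
      (+-cong (trans (*-congˡ (reflexive (δ-≢ (All.lookup p m)))) (zeroʳ _)) (sumOver-δ f u m))
      (+-identityˡ _)

-- Passing inequalities to the left limit at 1.

module LeftLimit (ℝ : CompleteOrderedField) where
  open OrderedField ℝ

  -- The limit says something only close to `1`, and the transport estimates are stated for `½ ≤ α`.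
  -- The witness `1# - η`, with `η` below both `δ` and `½`, meets both demands.
  sample : ∀ {δ} → 0# < δ → Σ[ α ∈ Carrier ] (½ ≤ α × 1# - δ < α × α < 1#)
  sample {δ} 0<δ with between 0<δ 0<½
  ... | η , 0<η , η<δ , η<½ = 1# - η
    , inj₁ (0<y-x⇒x<y (<-resp refl
        (trans (solve 2 (λ h e → h :- e := h :* con (+ 1) :+ h :* con (+ 1) :- e :- h) refl ½ η)
               (+-congʳ (+-congʳ (½+½ 1#))))
        (x<y⇒0<y-x η<½)))
    , 0<y-x⇒x<y (<-resp refl (solve 2 (λ d e → d :- e := con (+ 1) :- e :- (con (+ 1) :- d)) refl δ η)
        (x<y⇒0<y-x η<δ))
    , 0<y-x⇒x<y (<-resp refl (solve 1 (λ e → e := con (+ 1) :- (con (+ 1) :- e)) refl η) 0<η)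

  0≤-from-½≤ : ∀ {α} → ½ ≤ α → 0# ≤ α
  0≤-from-½≤ = ≤-trans (inj₁ 0<½)

  private
    cancel : ∀ {c} → 0# < c → ∀ x → x * c ⁻¹ * c ≈ x
    cancel {c} 0<c x = trans (solve 3 (λ x i c → x :* i :* c := c :* i :* x) refl x (c ⁻¹) c)
      (trans (*-congʳ (*-inverse 0<c)) (*-identityˡ x))

  limit-≤ : ∀ {f l c u} → HasLeftLimitAt1 f l → 0# < c →
            (∀ α → ½ ≤ α → α < 1# → f α * c ≤ u) → l * c ≤ u
  limit-≤ {f} {l} {c} {u} lim 0<c bound = ≮⇒≥ λ u<lc →
    -- `e` makes `e * c` equal to the gap `l * c - u`, so `l - e < f α` would give `u < f α * c`,
    -- against `bound`.
    let e                   = (l * c - u) * c ⁻¹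
        δ , 0<δ , close     = lim e (*-pos (x<y⇒0<y-x u<lc) (⁻¹-pos 0<c))
        α , ½≤α , 1-δ<α , α<1 = sample 0<δ
        below , _           = close α (0≤-from-½≤ ½≤α) 1-δ<α α<1
    in ≤⇒≯ (bound α ½≤α α<1) (0<y-x⇒x<y (<-resp refl
         (trans (solve 4 (λ f l e c → (f :- l :- :- e) :* c := (f :- l) :* c :+ e :* c) refl (f α) l e c)
           (trans (+-congˡ (cancel 0<c _))
             (solve 4 (λ f l c u → (f :- l) :* c :+ (l :* c :- u) := f :* c :- u) refl (f α) l c u)))
         (*-pos (x<y⇒0<y-x below) 0<c)))

  limit-≥ : ∀ {f l c u} → HasLeftLimitAt1 f l → 0# < c →
            (∀ α → ½ ≤ α → α < 1# → u ≤ f α * c) → u ≤ l * c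
  limit-≥ {f} {l} {c} {u} lim 0<c bound = ≮⇒≥ λ lc<u →
    let e                   = (u - l * c) * c ⁻¹
        δ , 0<δ , close     = lim e (*-pos (x<y⇒0<y-x lc<u) (⁻¹-pos 0<c))
        α , ½≤α , 1-δ<α , α<1 = sample 0<δ
        _ , above           = close α (0≤-from-½≤ ½≤α) 1-δ<α α<1
    in ≤⇒≯ (bound α ½≤α α<1) (0<y-x⇒x<y (<-resp refl
         (trans (solve 4 (λ f l e c → (e :- (f :- l)) :* c := e :* c :- (f :- l) :* c) refl (f α) l e c)
           (trans (+-congʳ (cancel 0<c _))
             (solve 4 (λ f l c u → u :- l :* c :- (f :- l) :* c := u :- f :* c) refl (f α) l c u)))
         (*-pos (x<y⇒0<y-x above) 0<c)))

-- Distances, couplings and curvature on a general weighted graph.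

module Transport (ℝ : CompleteOrderedField) (G : Graph) (w : Weighting ℝ G) where
  open OrderedField ℝ
  open Sums ℝ
  open LeftLimit ℝ
  open Graph G
  open Weighting w
  open LinLuYau ℝ G w public
  open Delta _≟_ public
  open import Relation.Binary.Reasoning.Setoid setoid

  Lipschitz : (Vertex → Carrier) → Set
  Lipschitz f = ∀ x y → x ~ y → f y - f x ≤ weight x y

  Lipschitz-neg : ∀ {f} → Lipschitz f → Lipschitz (λ v → - f v)
  Lipschitz-neg {f} lip x y x~y = ≤-resp
    (solve 2 (λ a b → a :- b := :- b :- :- a) refl (f x) (f y)) (weight-sym (~-sym x~y))
    (lip y x (~-sym x~y))

  pathWeight-≥ : ∀ {f} → Lipschitz f → ∀ {x y} (p : Star _~_ x y) → f y - f x ≤ pathWeight p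
  pathWeight-≥ {f} lip {x} ε = inj₂ (solve 1 (λ a → a :- a := con (+ 0)) refl (f x))
  pathWeight-≥ {f} lip {x} {z} (_◅_ {j = y} x~y p) = ≤-resp
    (solve 3 (λ a b c → b :- a :+ (c :- b) := c :- a) refl (f x) (f y) (f z)) refl
    (+-mono-≤ (lip x y x~y) (pathWeight-≥ lip p))

  pathWeight-◅◅ : ∀ {x y z} (p : Star _~_ x y) (q : Star _~_ y z) →
                  pathWeight (p ◅◅ q) ≈ pathWeight p + pathWeight q
  pathWeight-◅◅ ε       q = sym (+-identityˡ _)
  pathWeight-◅◅ (_ ◅ p) q = trans (+-congˡ (pathWeight-◅◅ p q))
    (solve 3 (λ a b c → a :+ (b :+ c) := a :+ b :+ c) refl _ _ _)

  Lipschitz-0 : Lipschitz (λ _ → 0#)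
  Lipschitz-0 x y x~y = ≤-trans (inj₂ (solve 0 (con (+ 0) :- con (+ 0) := con (+ 0)) refl)) (inj₁ (weight-pos x~y))

  pathWeight-nonneg : ∀ {x y} (p : Star _~_ x y) → 0# ≤ pathWeight p
  pathWeight-nonneg p = ≤-resp (solve 0 (con (+ 0) :- con (+ 0) := con (+ 0)) refl) refl (pathWeight-≥ Lipschitz-0 p)

  -- `inf` is specified only for inhabited sets that are bounded below: connectedness supplies a
  -- walk, and the zero potential supplies the bound `0#`.
  dist-isInfimum : ∀ x y → IsInfimum (λ r → Σ[ p ∈ Star _~_ x y ] r ≈ pathWeight p) (dist x y)
  dist-isInfimum x y = inf-isInfimum _ (pathWeight p , p , refl)
    (0# , λ r (q , r≈) → ≤-resp refl (sym r≈) (pathWeight-nonneg q))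
    where
    p : Star _~_ x y
    p = connected x y

  dist-≤ : ∀ {x y} (p : Star _~_ x y) → dist x y ≤ pathWeight p
  dist-≤ {x} {y} p = proj₁ (dist-isInfimum x y) _ (p , refl)

  dist-≥ : ∀ {f} → Lipschitz f → ∀ x y → f y - f x ≤ dist x y
  dist-≥ lip x y = proj₂ (dist-isInfimum x y) _ (λ r (p , r≈) → ≤-resp refl (sym r≈) (pathWeight-≥ lip p))

  dist-nonneg : ∀ x y → 0# ≤ dist x y
  dist-nonneg x y = ≤-resp (solve 0 (con (+ 0) :- con (+ 0) := con (+ 0)) refl) refl (dist-≥ Lipschitz-0 x y)

  module _ {μ₁ μ₂ : Vertex → Carrier} where

    cost-nonneg : ∀ {π} → IsCoupling π μ₁ μ₂ → 0# ≤ cost π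
    cost-nonneg c = sumOver-nonneg vertices λ u → sumOver-nonneg vertices λ v →
      0≤* (IsCoupling.nonneg c u v) (dist-nonneg u v)

    -- A coupling is an argument because the infimum is meaningful only once some coupling exists.
    -- Hence even the lower bound `wasserstein-≥` has to exhibit one.
    wasserstein-isInfimum : ∀ {π} → IsCoupling π μ₁ μ₂ →
      IsInfimum (λ r → Σ[ π ∈ (Vertex → Vertex → Carrier) ] (IsCoupling π μ₁ μ₂ × r ≈ cost π)) (wasserstein μ₁ μ₂)
    wasserstein-isInfimum {π} c = inf-isInfimum _ (cost π , π , c , refl)
      (0# , λ r (_ , c′ , r≈) → ≤-resp refl (sym r≈) (cost-nonneg c′))

    wasserstein-≤ : ∀ {π} → IsCoupling π μ₁ μ₂ → wasserstein μ₁ μ₂ ≤ cost π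
    wasserstein-≤ c = proj₁ (wasserstein-isInfimum c) _ (_ , c , refl)

    -- The easy half of Kantorovich duality.
    cost-≥ : ∀ {f π} → Lipschitz f → IsCoupling π μ₁ μ₂ →
             sumOver vertices (λ v → f v * μ₂ v) - sumOver vertices (λ v → f v * μ₁ v) ≤ cost π
    cost-≥ {f} {π} lip c = ≤-resp eq refl
      (sumOver-mono vertices λ u → sumOver-mono vertices λ v →
        *-monoˡ-≤ (IsCoupling.nonneg c u v) (dist-≥ lip u v))
      where
      eq : sumOver vertices (λ u → sumOver vertices (λ v → π u v * (f v - f u))) ≈
           sumOver vertices (λ v → f v * μ₂ v) - sumOver vertices (λ v → f v * μ₁ v)
      eq = begin
        sumOver vertices (λ u → sumOver vertices (λ v → π u v * (f v - f u)))
          ≈⟨ sumOver-cong vertices (λ u → trans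
               (sumOver-cong vertices (λ v → solve 3 (λ p a b → p :* (a :- b) := a :* p :- b :* p) refl (π u v) (f v) (f u)))
               (sumOver-- vertices (λ v → f v * π u v) (λ v → f u * π u v))) ⟩
        sumOver vertices (λ u → sumOver vertices (λ v → f v * π u v) - sumOver vertices (λ v → f u * π u v))
          ≈⟨ sumOver-- vertices (λ u → sumOver vertices (λ v → f v * π u v)) (λ u → sumOver vertices (λ v → f u * π u v)) ⟩
        sumOver vertices (λ u → sumOver vertices (λ v → f v * π u v)) - sumOver vertices (λ u → sumOver vertices (λ v → f u * π u v))
          ≈⟨ +-cong
               (trans (sumOver-comm vertices vertices (λ u v → f v * π u v))
                 (sumOver-cong vertices (λ v → trans (sumOver-*ˡ vertices (f v) (λ u → π u v))
                   (*-congˡ (IsCoupling.marginal₂ c v)))))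
               (-‿cong (sumOver-cong vertices (λ u → trans (sumOver-*ˡ vertices (f u) (π u))
                 (*-congˡ (IsCoupling.marginal₁ c u))))) ⟩
        sumOver vertices (λ v → f v * μ₂ v) - sumOver vertices (λ v → f v * μ₁ v) ∎

    wasserstein-≥ : ∀ {f π} → Lipschitz f → IsCoupling π μ₁ μ₂ →
      sumOver vertices (λ v → f v * μ₂ v) - sumOver vertices (λ v → f v * μ₁ v) ≤ wasserstein μ₁ μ₂
    wasserstein-≥ lip c = proj₂ (wasserstein-isInfimum c) _
      (λ r (_ , c′ , r≈) → ≤-resp refl (sym r≈) (cost-≥ lip c′))

  sum-δ : ∀ a (f : Vertex → Carrier) → sumOver vertices (λ v → f v * δ a v) ≈ f a
  sum-δ a f = sumOver-δ f unique (complete a)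

  μ-δ : ∀ α x v → μ α x v ≈ α * δ x v + (1# - α) / fromℕ (degree x) * indicator (does (x ~? v))
  μ-δ α x v with v ≟ x
  ... | yes ≡.refl = sym (trans
    (+-congˡ (*-congˡ (reflexive (indicator-no (v ~? v) ~-irrefl))))
    (solve 2 (λ a b → a :* con (+ 1) :+ b :* con (+ 0) := a) refl _ _))
  ... | no _ with does (x ~? v)
  ...   | true  = solve 2 (λ a b → b := a :* con (+ 0) :+ b :* con (+ 1)) refl _ _
  ...   | false = solve 2 (λ a b → con (+ 0) := a :* con (+ 0) :+ b :* con (+ 0)) refl _ _

  degree-indicator : ∀ x → fromℕ (degree x) ≈ sumOver vertices (λ v → indicator (does (x ~? v)))
  degree-indicator x = fromℕ-length-filter (x ~?_) vertices

  -- Formal sums of point masses: integrating against one collapses a sum over all vertices to a sum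
  -- over the list, and entries may share a vertex.
  mass : List (Carrier × Vertex) → Vertex → Carrier
  mass ms v = sumOver ms (λ (m , a) → m * δ a v)

  sum-mass : ∀ ms (f : Vertex → Carrier) →
             sumOver vertices (λ v → f v * mass ms v) ≈ sumOver ms (λ (m , a) → m * f a)
  sum-mass ms f = begin
    sumOver vertices (λ v → f v * mass ms v)
      ≈⟨ sumOver-cong vertices (λ v → sym (sumOver-*ˡ ms (f v) (λ (m , a) → m * δ a v))) ⟩
    sumOver vertices (λ v → sumOver ms (λ (m , a) → f v * (m * δ a v)))
      ≈⟨ sumOver-comm vertices ms (λ v (m , a) → f v * (m * δ a v)) ⟩
    sumOver ms (λ (m , a) → sumOver vertices (λ v → f v * (m * δ a v)))
      ≈⟨ sumOver-cong ms (λ (m , a) → trans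
           (sumOver-cong vertices (λ v → solve 3 (λ f m d → f :* (m :* d) := m :* f :* d) refl (f v) m (δ a v)))
           (sum-δ a (λ v → m * f v))) ⟩
    sumOver ms (λ (m , a) → m * f a) ∎

  -- A list of single moves (amount, source, target), from which the marginals and the cost can be
  -- read off.
  plan : List (Carrier × Vertex × Vertex) → Vertex → Vertex → Carrier
  plan ts u v = sumOver ts (λ (m , a , b) → m * (δ a u * δ b v))

  -- Taking `f` constantly `1#` gives the first marginal, and `f = dist u` gives the cost.
  sum-plan₁ : ∀ ts u (f : Vertex → Carrier) →
              sumOver vertices (λ v → plan ts u v * f v) ≈ sumOver ts (λ (m , a , b) → m * f b * δ a u)
  sum-plan₁ ts u f = begin
    sumOver vertices (λ v → plan ts u v * f v)
      ≈⟨ sumOver-cong vertices (λ v → trans (*-comm _ _) (sym (sumOver-*ˡ ts (f v) (λ (m , a , b) → m * (δ a u * δ b v))))) ⟩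
    sumOver vertices (λ v → sumOver ts (λ (m , a , b) → f v * (m * (δ a u * δ b v))))
      ≈⟨ sumOver-comm vertices ts (λ v (m , a , b) → f v * (m * (δ a u * δ b v))) ⟩
    sumOver ts (λ (m , a , b) → sumOver vertices (λ v → f v * (m * (δ a u * δ b v))))
      ≈⟨ sumOver-cong ts (λ (m , a , b) → trans
           (sumOver-cong vertices (λ v → solve 4 (λ f m d d′ → f :* (m :* (d :* d′)) := m :* f :* d :* d′) refl (f v) m (δ a u) (δ b v)))
           (sum-δ b (λ v → m * f v * δ a u))) ⟩
    sumOver ts (λ (m , a , b) → m * f b * δ a u) ∎

  plan-cost : ∀ ts → cost (plan ts) ≈ sumOver ts (λ (m , a , b) → m * dist a b)
  plan-cost ts = begin
    cost (plan ts)
      ≈⟨ sumOver-cong vertices (λ u → sum-plan₁ ts u (dist u)) ⟩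
    sumOver vertices (λ u → sumOver ts (λ (m , a , b) → m * dist u b * δ a u))
      ≈⟨ sumOver-comm vertices ts (λ u (m , a , b) → m * dist u b * δ a u) ⟩
    sumOver ts (λ (m , a , b) → sumOver vertices (λ u → m * dist u b * δ a u))
      ≈⟨ sumOver-cong ts (λ (m , a , b) → sum-δ a (λ u → m * dist u b)) ⟩
    sumOver ts (λ (m , a , b) → m * dist a b) ∎

  plan-marginal₁ : ∀ ts u → sumOver vertices (plan ts u) ≈ sumOver ts (λ (m , a , b) → m * δ a u)
  plan-marginal₁ ts u = trans
    (sumOver-cong vertices (λ v → solve 1 (λ p → p := p :* con (+ 1)) refl (plan ts u v)))
    (trans (sum-plan₁ ts u (λ _ → 1#))
      (sumOver-cong ts (λ (m , a , b) → solve 2 (λ m d → m :* con (+ 1) :* d := m :* d) refl m (δ a u))))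

  plan-marginal₂ : ∀ ts v → sumOver vertices (λ u → plan ts u v) ≈ sumOver ts (λ (m , a , b) → m * δ b v)
  plan-marginal₂ ts v = trans
    (sumOver-comm vertices ts (λ u (m , a , b) → m * (δ a u * δ b v)))
    (sumOver-cong ts (λ (m , a , b) → trans
      (sumOver-cong vertices (λ u → solve 3 (λ m d d′ → m :* (d :* d′) := m :* d′ :* d) refl m (δ a u) (δ b v)))
      (sum-δ a (λ _ → m * δ b v))))

  plan-isCoupling : ∀ {ts μ₁ μ₂} → All (λ (m , _) → 0# ≤ m) ts →
                    (∀ u → sumOver ts (λ (m , a , b) → m * δ a u) ≈ μ₁ u) →
                    (∀ v → sumOver ts (λ (m , a , b) → m * δ b v) ≈ μ₂ v) →
                    IsCoupling (plan ts) μ₁ μ₂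
  plan-isCoupling {ts} pos p q = record
    { nonneg    = λ u v → nonneg u v pos
    ; marginal₁ = λ u → trans (plan-marginal₁ ts u) (p u)
    ; marginal₂ = λ v → trans (plan-marginal₂ ts v) (q v)
    }
    where
    nonneg : ∀ u v {ts} → All (λ (m , _) → 0# ≤ m) ts → 0# ≤ plan ts u v
    nonneg u v All.[]       = ≤-refl
    nonneg u v (p All.∷ ps) = 0≤+ (0≤* p (0≤* (indicator-nonneg _) (indicator-nonneg _))) (nonneg u v ps)

  module _ {x y : Vertex} {n κ u : Carrier} (κ-lim : HasCurvature x y κ) (0<n : 0# < n) (0<dist : 0# < dist x y) where

    private
      -- Clears every denominator: up to the positive factor `(1# - α) / n`, the scaled difference
      -- quotient is the saving `dist x y - W`.
      rescale : ∀ α → α < 1# → let W = wasserstein (μ α x) (μ α y) in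
                (1# - α) / n * (κα α x y / (1# - α) * (n * dist x y)) ≈ dist x y - W
      rescale α α<1 = begin
        s * n ⁻¹ * ((1# - W * D ⁻¹) * s ⁻¹ * (n * D))
          ≈⟨ solve 7 (λ s s′ n n′ d d′ w → s :* n′ :* ((con (+ 1) :- w :* d′) :* s′ :* (n :* d)) :=
                        (s :* s′) :* (n :* n′) :* (d :- w :* (d :* d′))) refl s (s ⁻¹) n (n ⁻¹) D (D ⁻¹) W ⟩
        (s * s ⁻¹) * (n * n ⁻¹) * (D - W * (D * D ⁻¹))
          ≈⟨ *-cong (*-cong (*-inverse (x<y⇒0<y-x α<1)) (*-inverse 0<n))
               (+-congˡ (-‿cong (*-congˡ (*-inverse 0<dist)))) ⟩
        1# * 1# * (D - W * 1#)
          ≈⟨ solve 2 (λ d w → con (+ 1) :* con (+ 1) :* (d :- w :* con (+ 1)) := d :- w) refl D W ⟩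
        D - W ∎
        where
        s = 1# - α
        D = dist x y
        W = wasserstein (μ α x) (μ α y)

      0<β : ∀ {α} → α < 1# → 0# < (1# - α) / n
      0<β α<1 = *-pos (x<y⇒0<y-x α<1) (⁻¹-pos 0<n)

    -- The hypothesis is linear in `1# - α` on all of `[½, 1)`, so the resulting bound on the
    -- quotient does not depend on `α` and survives the limit.
    curvature-≤ : (∀ α → ½ ≤ α → α < 1# → dist x y - (1# - α) / n * u ≤ wasserstein (μ α x) (μ α y)) →
                  κ * (n * dist x y) ≤ u
    curvature-≤ bound = limit-≤ κ-lim (*-pos 0<n 0<dist) λ α ½≤α α<1 →
      *-cancelˡ-≤ (0<β α<1) (≤-resp (sym (rescale α α<1)) refl
        (0≤y-x⇒x≤y (≤-resp refl
          (solve 3 (λ d b w → w :- (d :- b) := b :- (d :- w)) refl (dist x y) ((1# - α) / n * u) (wasserstein (μ α x) (μ α y)))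
          (x≤y⇒0≤y-x (bound α ½≤α α<1)))))

    curvature-≥ : (∀ α → ½ ≤ α → α < 1# → wasserstein (μ α x) (μ α y) ≤ dist x y - (1# - α) / n * u) →
                  u ≤ κ * (n * dist x y)
    curvature-≥ bound = limit-≥ κ-lim (*-pos 0<n 0<dist) λ α ½≤α α<1 →
      *-cancelˡ-≤ (0<β α<1) (≤-resp refl (sym (rescale α α<1))
        (0≤y-x⇒x≤y (≤-resp refl
          (solve 3 (λ d b w → d :- b :- w := d :- w :- b) refl (dist x y) ((1# - α) / n * u) (wasserstein (μ α x) (μ α y)))
          (x≤y⇒0≤y-x (bound α ½≤α α<1)))))

-- Rotations of the cyclic index set.

next^ : ∀ {g} → ℕ → Fin g → Fin g
next^ zero    i = i
next^ (suc k) i = next (next^ k i)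

next^-next : ∀ {g} k (i : Fin g) → next^ k (next i) ≡ next (next^ k i)
next^-next zero    i = ≡.refl
next^-next (suc k) i = ≡.cong next (next^-next k i)

toℕ-next^ : ∀ {n} k (i : Fin (suc n)) → toℕ (next^ k i) ≡ (toℕ i ℕ.+ k) % suc n
toℕ-next^ {n} zero    i = ≡.sym (≡.trans (≡.cong (_% suc n) (ℕ.+-identityʳ (toℕ i))) (m<n⇒m%n≡m (toℕ<n i)))
toℕ-next^ {n} (suc k) i = begin
  toℕ (next (next^ k i))                                      ≡⟨ toℕ-next (next^ k i) ⟩
  suc (toℕ (next^ k i)) % suc n                               ≡⟨ ≡.cong (λ m → suc m % suc n) (toℕ-next^ k i) ⟩
  (1 ℕ.+ s % suc n) % suc n                                   ≡⟨ %-distribˡ-+ 1 (s % suc n) (suc n) ⟩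
  (1 % suc n ℕ.+ s % suc n % suc n) % suc n                   ≡⟨ ≡.cong (λ m → (1 % suc n ℕ.+ m) % suc n) (m%n%n≡m%n s (suc n)) ⟩
  (1 % suc n ℕ.+ s % suc n) % suc n                           ≡⟨ %-distribˡ-+ 1 s (suc n) ⟨
  suc s % suc n                                               ≡⟨ ≡.cong (_% suc n) (ℕ.+-suc (toℕ i) k) ⟨
  (toℕ i ℕ.+ suc k) % suc n                                   ∎
  where
  open ≡.≡-Reasoning
  s = toℕ i ℕ.+ k

next^-period : ∀ {g} (i : Fin g) → next^ g i ≡ i
next^-period {suc n} i = toℕ-injective
  (≡.trans (toℕ-next^ (suc n) i) (≡.trans ([m+n]%n≡m%n (toℕ i) (suc n)) (m<n⇒m%n≡m (toℕ<n i))))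

-- Since `k < g`, the number `toℕ i + k` is below `2g`. Reduction modulo `g` either leaves it
-- unchanged, hence above `toℕ i`, or subtracts `g` once, which lands below `toℕ i`.
next^-≢ : ∀ {g k} (i : Fin g) → 0 ℕ.< k → k ℕ.< g → next^ k i ≢ i
next^-≢ {suc n} {k} i 0<k k<g eq with (toℕ i ℕ.+ k) ℕ.<? suc n
... | yes lt = ℕ.<⇒≢ (ℕ.m<m+n (toℕ i) 0<k)
  (≡.trans (≡.sym (≡.cong toℕ eq)) (≡.trans (toℕ-next^ k i) (m<n⇒m%n≡m lt)))
... | no ¬lt = ℕ.<⇒≢ r<i (≡.trans (≡.sym r-mod) (≡.trans (≡.sym (toℕ-next^ k i)) (≡.cong toℕ eq)))
  where
  r = (toℕ i ℕ.+ k) ℕ.∸ suc n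
  r+g : r ℕ.+ suc n ≡ toℕ i ℕ.+ k
  r+g = ℕ.m∸n+n≡m (ℕ.≮⇒≥ ¬lt)
  r<i : r ℕ.< toℕ i
  r<i = ℕ.+-cancelʳ-< (suc n) r (toℕ i) (ℕ.≤-<-trans (ℕ.≤-reflexive r+g) (ℕ.+-monoʳ-< (toℕ i) k<g))
  r-mod : (toℕ i ℕ.+ k) % suc n ≡ r
  r-mod = ≡.trans (≡.cong (_% suc n) (≡.sym r+g))
    (≡.trans ([m+n]%n≡m%n r (suc n)) (m<n⇒m%n≡m (ℕ.<-trans r<i (toℕ<n i))))

-- One step back is `g - 1` steps forward, so both inverse laws come from `next^-period`.
prev : ∀ {g} → Fin g → Fin g
prev {g} i = next^ (g ℕ.∸ 1) i

next-prev : ∀ {g} (i : Fin g) → next (prev i) ≡ i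
next-prev {suc n} i = next^-period i

prev-next : ∀ {g} (i : Fin g) → prev (next i) ≡ i
prev-next {suc n} i = ≡.trans (next^-next n i) (next^-period i)

-- Shift-invariant sums and potentials on the cycle.

module CyclicSums (ℝ : CompleteOrderedField) (g : ℕ) where
  open OrderedField ℝ
  open Sums ℝ
  open Delta (_≟ᶠ_ {g}) public using (δ; δ-refl; δ-≢)
  open Delta (_≟ᶠ_ {g}) using (sumOver-δ)
  open import Relation.Binary.Reasoning.Setoid setoid

  ∑ : (Fin g → Carrier) → Carrier
  ∑ = sumOver (allFin g)

  ∑-δ : ∀ a (f : Fin g → Carrier) → ∑ (λ i → f i * δ a i) ≈ f a
  ∑-δ a f = sumOver-δ f (Unique.allFin⁺ g) (∈-allFin a)

  -- Removing the terms at `a` and `b` leaves a nonnegative function that is still positive at `c`.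
  -- The third index is what `3 ≤ g` provides later.
  ∑->-two : ∀ {f : Fin g → Carrier} → (∀ i → 0# < f i) → ∀ {a b c} → a ≢ b → c ≢ a → c ≢ b → f a + f b < ∑ f
  ∑->-two {f} 0<f {a} {b} {c} a≢b c≢a c≢b = 0<y-x⇒x<y (<-resp refl ∑rest
    (sumOver-pos {f = rest} (λ i → nonneg i (i ≟ᶠ a) (i ≟ᶠ b)) (∈-allFin c) (<-resp refl (sym (rest-other c≢a c≢b)) (0<f c))))
    where
    rest : Fin g → Carrier
    rest i = f i - (f i * δ a i + f i * δ b i)

    rest-value : ∀ {i x y} → δ a i ≡ x → δ b i ≡ y → rest i ≈ f i - (f i * x + f i * y)
    rest-value p q = +-congˡ (-‿cong (+-cong (*-congˡ (reflexive p)) (*-congˡ (reflexive q))))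

    rest-other : ∀ {i} → i ≢ a → i ≢ b → rest i ≈ f i
    rest-other {i} i≢a i≢b = trans (rest-value (δ-≢ i≢a) (δ-≢ i≢b))
      (solve 1 (λ x → x :- (x :* con (+ 0) :+ x :* con (+ 0)) := x) refl (f i))

    nonneg : ∀ i → Dec (i ≡ a) → Dec (i ≡ b) → 0# ≤ rest i
    nonneg i (yes i≡a) (yes i≡b) = contradiction (≡.trans (≡.sym i≡a) i≡b) a≢b
    nonneg i (yes ≡.refl) (no i≢b) = inj₂ (sym (trans (rest-value (δ-refl i) (δ-≢ i≢b))
      (solve 1 (λ x → x :- (x :* con (+ 1) :+ x :* con (+ 0)) := con (+ 0)) refl (f i))))
    nonneg i (no i≢a) (yes ≡.refl) = inj₂ (sym (trans (rest-value (δ-≢ i≢a) (δ-refl i))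
      (solve 1 (λ x → x :- (x :* con (+ 0) :+ x :* con (+ 1)) := con (+ 0)) refl (f i))))
    nonneg i (no i≢a) (no i≢b) = inj₁ (<-resp refl (sym (rest-other i≢a i≢b)) (0<f i))

    ∑rest : ∑ rest ≈ ∑ f - (f a + f b)
    ∑rest = trans (sumOver-- (allFin g) f (λ i → f i * δ a i + f i * δ b i)) (+-congˡ (-‿cong
      (trans (sumOver-+ (allFin g) (λ i → f i * δ a i) (λ i → f i * δ b i)) (+-cong (∑-δ a f) (∑-δ b f)))))

  δ-next : ∀ i j → δ (next j) i ≡ δ (prev i) j
  δ-next i j with j ≟ᶠ prev i
  ... | yes j≡ = indicator-yes (i ≟ᶠ next j) (≡.sym (≡.trans (≡.cong next j≡) (next-prev i)))
  ... | no  j≢ = δ-≢ λ i≡ → j≢ (≡.sym (≡.trans (≡.cong prev i≡) (prev-next j)))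

  -- Change of variables along the bijection `next`: expand each value with a delta kernel, swap the
  -- sums, and transpose the kernel by `δ-next`.
  ∑-next : ∀ (f : Fin g → Carrier) → ∑ (λ j → f (next j)) ≈ ∑ f
  ∑-next f = begin
    ∑ (λ j → f (next j))                  ≈⟨ sumOver-cong (allFin g) (λ j → sym (∑-δ (next j) f)) ⟩
    ∑ (λ j → ∑ (λ i → f i * δ (next j) i)) ≈⟨ sumOver-comm (allFin g) (allFin g) (λ j i → f i * δ (next j) i) ⟩
    ∑ (λ i → ∑ (λ j → f i * δ (next j) i)) ≈⟨ sumOver-cong (allFin g) (λ i → trans
                                                (sumOver-cong (allFin g) (λ j → *-congˡ (reflexive (δ-next i j))))
                                                (∑-δ (prev i) (λ _ → f i))) ⟩
    ∑ f                                   ∎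

  ∑-prev : ∀ (f : Fin g → Carrier) → ∑ (λ j → f (prev j)) ≈ ∑ f
  ∑-prev f = trans (sym (∑-next (λ j → f (prev j))))
    (sumOver-cong (allFin g) (λ j → reflexive (≡.cong f (prev-next j))))

  module _ (e : Fin g → Carrier) where

    -- A full cyclic sum with a cut-off indicator: `k` may be any natural number, including `g`, and
    -- consecutive values differ by a delta term.
    partialSum : ℕ → Carrier
    partialSum k = ∑ (λ i → e i * indicator (does (toℕ i ℕ.<? k)))

    indicator-suc : ∀ i j → indicator (does (toℕ i ℕ.<? suc (toℕ j))) ≈ indicator (does (toℕ i ℕ.<? toℕ j)) + δ j i
    indicator-suc i j with ℕ.<-cmp (toℕ i) (toℕ j)
    ... | tri< i<j i≢j _ = trans
      (reflexive (indicator-yes (toℕ i ℕ.<? suc (toℕ j)) (ℕ.m<n⇒m<1+n i<j)))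
      (sym (trans (+-cong (reflexive (indicator-yes (toℕ i ℕ.<? toℕ j) i<j))
                          (reflexive (δ-≢ λ i≡j → i≢j (≡.cong toℕ i≡j)))) (+-identityʳ 1#)))
    ... | tri≈ i≮j i≡j _ = trans
      (reflexive (indicator-yes (toℕ i ℕ.<? suc (toℕ j)) (ℕ.s≤s (ℕ.≤-reflexive i≡j))))
      (sym (trans (+-cong (reflexive (indicator-no (toℕ i ℕ.<? toℕ j) i≮j))
                          (reflexive (indicator-yes (i ≟ᶠ j) (toℕ-injective i≡j)))) (+-identityˡ 1#)))
    ... | tri> i≮j i≢j j<i = trans
      (reflexive (indicator-no (toℕ i ℕ.<? suc (toℕ j)) (ℕ.≤⇒≯ j<i)))
      (sym (trans (+-cong (reflexive (indicator-no (toℕ i ℕ.<? toℕ j) i≮j))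
                          (reflexive (δ-≢ λ i≡j → i≢j (≡.cong toℕ i≡j)))) (+-identityˡ 0#)))

    partialSum-suc : ∀ j → partialSum (suc (toℕ j)) ≈ partialSum (toℕ j) + e j
    partialSum-suc j = begin
      partialSum (suc (toℕ j))
        ≈⟨ sumOver-cong (allFin g) (λ i → trans (*-congˡ (indicator-suc i j)) (distribˡ _ _ _)) ⟩
      ∑ (λ i → e i * indicator (does (toℕ i ℕ.<? toℕ j)) + e i * δ j i)
        ≈⟨ sumOver-+ (allFin g) (λ i → e i * indicator (does (toℕ i ℕ.<? toℕ j))) (λ i → e i * δ j i) ⟩
      partialSum (toℕ j) + ∑ (λ i → e i * δ j i)
        ≈⟨ +-congˡ (∑-δ j e) ⟩
      partialSum (toℕ j) + e j ∎

    partialSum-zero : partialSum 0 ≈ 0#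
    partialSum-zero = trans (sumOver-cong (allFin g) (λ i → zeroʳ (e i))) (sumOver-0 (allFin g))

    partialSum-all : partialSum g ≈ ∑ e
    partialSum-all = sumOver-cong (allFin g) λ i →
      trans (*-congˡ (reflexive (indicator-yes (toℕ i ℕ.<? g) (toℕ<n i)))) (trans (*-comm _ _) (*-identityˡ _))

    -- The issue is the step from the last index back to `0`: there the two sides are `0#` and the
    -- full sum, which agree by `∑ e ≈ 0#`.
    partialSum-next : ∑ e ≈ 0# → ∀ (j : Fin g) → partialSum (toℕ (next j)) ≈ partialSum (suc (toℕ j))
    partialSum-next ∑e≈0 j with ℕ.m≤n⇒m<n∨m≡n (toℕ<n j)
    ... | inj₁ lt = reflexive (≡.cong partialSum (toℕ-next-< j lt))
      where
      toℕ-next-< : ∀ {n} (j : Fin n) → suc (toℕ j) ℕ.< n → toℕ (next j) ≡ suc (toℕ j)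
      toℕ-next-< {suc n} j lt = ≡.trans (toℕ-next j) (m<n⇒m%n≡m lt)
    ... | inj₂ eq = begin
      partialSum (toℕ (next j))   ≡⟨ ≡.cong partialSum (toℕ-next-≡ j eq) ⟩
      partialSum 0                ≈⟨ partialSum-zero ⟩
      0#                          ≈⟨ ∑e≈0 ⟨
      ∑ e                         ≈⟨ partialSum-all ⟨
      partialSum g                ≡⟨ ≡.cong partialSum eq ⟨
      partialSum (suc (toℕ j))    ∎
      where
      toℕ-next-≡ : ∀ {n} (j : Fin n) → suc (toℕ j) ≡ n → toℕ (next j) ≡ 0
      toℕ-next-≡ {suc n} j eq = ≡.trans (toℕ-next j) (≡.trans (≡.cong (_% suc n) eq) (n%n≡0 (suc n)))

    -- A 1-form on a cycle with zero total is exact. The primitive is minus the partial sum because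
    -- drops are taken in the direction of `next`.
    coboundary : ∑ e ≈ 0# → Σ[ f ∈ (Fin g → Carrier) ] (∀ j → f j - f (next j) ≈ e j)
    coboundary ∑e≈0 = (λ j → - partialSum (toℕ j)) , λ j → trans
      (+-congˡ (-‿cong (-‿cong (trans (partialSum-next ∑e≈0 j) (partialSum-suc j)))))
      (solve 2 (λ p e → :- p :- :- (p :+ e) := e) refl (partialSum (toℕ j)) (e j))

-- Measures, transport plans and edge weights on the sun graph.

module SunTransport (ℝ : CompleteOrderedField) (g d : ℕ) (3≤g : 3 ℕ.≤ g) (3≤d : 3 ℕ.≤ d)
                    (w : Weighting ℝ (sunGraph g d 3≤g)) where
  open OrderedField ℝ
  open Sums ℝ
  open LeftLimit ℝ using (0≤-from-½≤)
  open Sun g d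
  open Graph (sunGraph g d 3≤g) using (vertices; degree)
  open Weighting w
  open Transport ℝ (sunGraph g d 3≤g) w
  open CyclicSums ℝ g using (∑; ∑->-two; ∑-next; ∑-prev; ∑-δ; coboundary)
    renaming (δ to δᶠ; δ-refl to δᶠ-refl; δ-≢ to δᶠ-≢)
  open CycleEdges ℝ g d 3≤g w
  open import Relation.Binary.Reasoning.Setoid setoid

  leaves : List (Fin (d ℕ.∸ 2))
  leaves = allFin (d ℕ.∸ 2)

  neighbours : Fin g → List SunVertex
  neighbours i = cyc (next i) ∷ cyc (prev i) ∷ map (leaf i) leaves

  -- Equality would make `next` an involution, which `3 ≤ g` excludes. It keeps the two cycle
  -- neighbours apart, so that the adjacency indicator is a plain sum of deltas.
  next≢prev : ∀ i → next i ≢ prev i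
  next≢prev i eq = next^-≢ {k = 2} i (ℕ.s≤s ℕ.z≤n) 3≤g (≡.trans (≡.cong next eq) (next-prev i))

  private
    leaf-δ-∉ : ∀ i v → (∀ k → v ≢ leaf i k) → sumOver leaves (λ k → δ (leaf i k) v) ≈ 0#
    leaf-δ-∉ i v v≢ = trans (sumOver-cong leaves (λ k → reflexive (δ-≢ (v≢ k)))) (sumOver-0 leaves)

    leaf-δ : ∀ i k → sumOver leaves (λ k′ → δ (leaf i k′) (leaf i k)) ≈ 1#
    leaf-δ i k = trans (sumOver-cong leaves (λ k′ → trans (reflexive (eq k′)) (sym (*-identityˡ _))))
      (Delta.sumOver-δ _≟ᶠ_ (λ _ → 1#) (Unique.allFin⁺ _) (∈-allFin k))
      where
      eq : ∀ k′ → δ (leaf i k′) (leaf i k) ≡ Delta.δ _≟ᶠ_ k k′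
      eq k′ = cases (k′ ≟ᶠ k)
        where
        cases : Dec (k′ ≡ k) → δ (leaf i k′) (leaf i k) ≡ Delta.δ _≟ᶠ_ k k′
        cases (yes ≡.refl) = ≡.trans (δ-refl (leaf i k)) (≡.sym (Delta.δ-refl _≟ᶠ_ k))
        cases (no k′≢k)    = ≡.trans (δ-≢ {leaf i k′} {leaf i k} λ { ≡.refl → k′≢k ≡.refl }) (≡.sym (Delta.δ-≢ _≟ᶠ_ k′≢k))

  adjacent-δ : ∀ i v → indicator (does (adjacent? (cyc i) v)) ≈
    δ (cyc (next i)) v + (δ (cyc (prev i)) v + sumOver leaves (λ k → δ (leaf i k) v))
  adjacent-δ i (cyc j) = cases (j ≟ᶠ next i) (j ≟ᶠ prev i)
    where
    cases : Dec (j ≡ next i) → Dec (j ≡ prev i) → indicator (does (adjacent? (cyc i) (cyc j))) ≈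
      δ (cyc (next i)) (cyc j) + (δ (cyc (prev i)) (cyc j) + sumOver leaves (λ k → δ (leaf i k) (cyc j)))
    cases (yes ≡.refl) _ = trans (reflexive (indicator-yes (adjacent? (cyc i) (cyc j)) (inj₁ ≡.refl)))
      (sym (trans (+-cong (reflexive (δ-refl (cyc j)))
        (+-cong (reflexive (δ-≢ {cyc (prev i)} {cyc j} λ eq → next≢prev i (inj₁-injective eq))) (leaf-δ-∉ i (cyc j) (λ k ()))))
        (solve 0 (con (+ 1) :+ (con (+ 0) :+ con (+ 0)) := con (+ 1)) refl)))
    cases (no j≢next) (yes ≡.refl) = trans
      (reflexive (indicator-yes (adjacent? (cyc i) (cyc j)) (inj₂ (≡.sym (next-prev i)))))
      (sym (trans (+-cong (reflexive (δ-≢ {cyc (next i)} {cyc j} λ eq → j≢next (inj₁-injective eq)))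
        (+-cong (reflexive (δ-refl (cyc j))) (leaf-δ-∉ i (cyc j) (λ k ()))))
        (solve 0 (con (+ 0) :+ (con (+ 1) :+ con (+ 0)) := con (+ 1)) refl)))
    cases (no j≢next) (no j≢prev) = trans
      (reflexive (indicator-no (adjacent? (cyc i) (cyc j))
        λ { (inj₁ eq) → j≢next eq ; (inj₂ eq) → j≢prev (≡.sym (≡.trans (≡.cong prev eq) (prev-next j))) }))
      (sym (trans (+-cong (reflexive (δ-≢ {cyc (next i)} {cyc j} λ eq → j≢next (inj₁-injective eq)))
        (+-cong (reflexive (δ-≢ {cyc (prev i)} {cyc j} λ eq → j≢prev (inj₁-injective eq))) (leaf-δ-∉ i (cyc j) (λ k ()))))
        (solve 0 (con (+ 0) :+ (con (+ 0) :+ con (+ 0)) := con (+ 0)) refl)))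
  adjacent-δ i (leaf j k) = cases (i ≟ᶠ j)
    where
    cases : Dec (i ≡ j) → indicator (does (adjacent? (cyc i) (leaf j k))) ≈
      δ (cyc (next i)) (leaf j k) + (δ (cyc (prev i)) (leaf j k) + sumOver leaves (λ k′ → δ (leaf i k′) (leaf j k)))
    cases (yes ≡.refl) = trans (reflexive (indicator-yes (adjacent? (cyc i) (leaf j k)) ≡.refl)) (sym (trans
      (+-cong (reflexive (δ-≢ {cyc (next i)} {leaf j k} λ ())) (+-cong (reflexive (δ-≢ {cyc (prev i)} {leaf j k} λ ())) (leaf-δ i k)))
      (solve 0 (con (+ 0) :+ (con (+ 0) :+ con (+ 1)) := con (+ 1)) refl)))
    cases (no i≢j) = trans (reflexive (indicator-no (adjacent? (cyc i) (leaf j k)) i≢j)) (sym (trans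
      (+-cong (reflexive (δ-≢ {cyc (next i)} {leaf j k} λ ())) (+-cong (reflexive (δ-≢ {cyc (prev i)} {leaf j k} λ ())) (leaf-δ-∉ i (leaf j k) λ { k ≡.refl → i≢j ≡.refl })))
      (solve 0 (con (+ 0) :+ (con (+ 0) :+ con (+ 0)) := con (+ 0)) refl)))

  leafCount : Carrier
  leafCount = sumOver leaves (λ _ → 1#)

  -- The degree `d` of a cycle vertex, unfolded along `neighbours` so that the solver can cancel
  -- `leafCount` against sums over the leaves.
  deg : Carrier
  deg = 1# + (1# + leafCount)

  0≤leafCount : 0# ≤ leafCount
  0≤leafCount = sumOver-nonneg leaves (λ _ → inj₁ 0<1)

  0<deg : 0# < deg
  0<deg = 0<+ 0<1 (0≤+ (inj₁ 0<1) 0≤leafCount)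

  neighbourMass : Carrier → Fin g → List (Carrier × SunVertex)
  neighbourMass β i = map (β ,_) (neighbours i)

  sum-neighbourMass : ∀ β i (f : SunVertex → Carrier) →
    sumOver (neighbourMass β i) (λ (m , a) → m * f a) ≈
    β * (f (cyc (next i)) + (f (cyc (prev i)) + sumOver leaves (λ k → f (leaf i k))))
  sum-neighbourMass β i f = begin
    sumOver (neighbourMass β i) (λ (m , a) → m * f a)  ≡⟨ sumOver-map (neighbours i) (β ,_) _ ⟩
    sumOver (neighbours i) (λ a → β * f a)             ≈⟨ sumOver-*ˡ (neighbours i) β f ⟩
    β * sumOver (neighbours i) f                       ≡⟨ ≡.cong (λ s → β * (f (cyc (next i)) + (f (cyc (prev i)) + s))) (sumOver-map leaves (leaf i) f) ⟩
    β * (f (cyc (next i)) + (f (cyc (prev i)) + sumOver leaves (λ k → f (leaf i k)))) ∎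

  degree-cyc : ∀ i → fromℕ (degree (cyc i)) ≈ deg
  degree-cyc i = begin
    fromℕ (degree (cyc i))                                      ≈⟨ degree-indicator (cyc i) ⟩
    sumOver vertices (λ v → indicator (does (adjacent? (cyc i) v)))
      ≈⟨ sumOver-cong vertices (λ v → trans (adjacent-δ i v) (trans (sym (*-identityˡ _))
           (trans (sym (sum-neighbourMass 1# i (λ a → δ a v))) (sym (*-identityˡ _))))) ⟩
    sumOver vertices (λ v → 1# * mass (neighbourMass 1# i) v)   ≈⟨ sum-mass (neighbourMass 1# i) (λ _ → 1#) ⟩
    sumOver (neighbourMass 1# i) (λ (m , a) → m * 1#)           ≈⟨ sum-neighbourMass 1# i (λ _ → 1#) ⟩
    1# * deg                                                    ≈⟨ *-identityˡ deg ⟩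
    deg                                                         ∎

  μ-cyc : ∀ α i v → μ α (cyc i) v ≈ α * δ (cyc i) v + (1# - α) / deg *
    (δ (cyc (next i)) v + (δ (cyc (prev i)) v + sumOver leaves (λ k → δ (leaf i k) v)))
  μ-cyc α i v = trans (μ-δ α (cyc i) v) (+-congˡ (*-cong
    (*-congˡ (sym (⁻¹-cong 0<deg (sym (degree-cyc i))))) (adjacent-δ i v)))

  sum-μ : ∀ α i (f : SunVertex → Carrier) → sumOver vertices (λ v → f v * μ α (cyc i) v) ≈
    α * f (cyc i) + (1# - α) / deg * (f (cyc (next i)) + (f (cyc (prev i)) + sumOver leaves (λ k → f (leaf i k))))
  sum-μ α i f = begin
    sumOver vertices (λ v → f v * μ α (cyc i) v)
      ≈⟨ sumOver-cong vertices (λ v → *-congˡ (trans (μ-cyc α i v)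
           (+-congˡ (sym (sum-neighbourMass ((1# - α) / deg) i (λ a → δ a v)))))) ⟩
    sumOver vertices (λ v → f v * mass masses v)        ≈⟨ sum-mass masses f ⟩
    sumOver masses (λ (m , a) → m * f a)                ≈⟨ +-congˡ (sum-neighbourMass ((1# - α) / deg) i f) ⟩
    α * f (cyc i) + (1# - α) / deg * (f (cyc (next i)) + (f (cyc (prev i)) + sumOver leaves (λ k → f (leaf i k)))) ∎
    where
    masses : List (Carrier × SunVertex)
    masses = (α , cyc i) ∷ neighbourMass ((1# - α) / deg) i

  -- Moves the measure at next j to that at j; the mass β common to both at j and at next j stays put.
  transports : Carrier → Carrier → Fin g → List (Carrier × SunVertex × SunVertex)
  transports α β j =
    (α - β , cyc (next j)        , cyc j) ∷
    (β     , cyc (next j)        , cyc (next j)) ∷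
    (β     , cyc j               , cyc j) ∷
    (β     , cyc (next (next j)) , cyc (prev j)) ∷
    map (λ k → β , leaf (next j) k , leaf j k) leaves

  sum-transports : ∀ α β j (f : SunVertex → SunVertex → Carrier) →
    sumOver (transports α β j) (λ (m , a , b) → m * f a b) ≈
    (α - β) * f (cyc (next j)) (cyc j) + (β * f (cyc (next j)) (cyc (next j)) + (β * f (cyc j) (cyc j) +
    (β * f (cyc (next (next j))) (cyc (prev j)) + β * sumOver leaves (λ k → f (leaf (next j) k) (leaf j k)))))
  sum-transports α β j f = +-congˡ (+-congˡ (+-congˡ (+-congˡ (trans
    (reflexive (sumOver-map leaves (λ k → β , leaf (next j) k , leaf j k) (λ (m , a , b) → m * f a b)))
    (sumOver-*ˡ leaves β (λ k → f (leaf (next j) k) (leaf j k)))))))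

  deg*β : ∀ α → deg * ((1# - α) / deg) ≈ 1# - α
  deg*β α = trans (solve 3 (λ n s i → n :* (s :* i) := n :* i :* s) refl deg (1# - α) (deg ⁻¹))
    (trans (*-congʳ (*-inverse 0<deg)) (*-identityˡ _))

  α-β : ∀ α → α ≈ 1# - deg * ((1# - α) / deg)
  α-β α = trans (solve 1 (λ a → a := con (+ 1) :- (con (+ 1) :- a)) refl α) (+-congˡ (-‿cong (sym (deg*β α))))

  -- Here `½ ≤ α` is used: `deg * α ≥ 2α ≥ 1 ≥ 1 - α`. It makes the first amount `α - β` of the plan
  -- nonnegative.
  β≤α : ∀ {α} → ½ ≤ α → (1# - α) / deg ≤ α
  β≤α {α} ½≤α = *-cancelˡ-≤ 0<deg (≤-trans (inj₂ (deg*β α)) (0≤y-x⇒x≤y (≤-resp refl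
    (trans
      (solve 3 (λ a n h → (a :- h) :+ (a :- h) :+ (n :* a :+ a) :=
                          (con (+ 1) :+ (con (+ 1) :+ n)) :* a :- (h :* con (+ 1) :+ h :* con (+ 1) :- a)) refl α leafCount ½)
      (+-congˡ (-‿cong (+-congʳ (½+½ 1#)))))
    (0≤+ (0≤+ 0≤α-½ 0≤α-½) (0≤+ (0≤* 0≤leafCount 0≤α) 0≤α)))))
    where
    0≤α   = 0≤-from-½≤ ½≤α
    0≤α-½ = x≤y⇒0≤y-x ½≤α

  -- Both marginals are formal identities between sums of deltas, so coincidences of vertices, such
  -- as `next (next j)` with `prev j` when `g = 3`, need no case split.
  transports-isCoupling : ∀ {α} → ½ ≤ α → α < 1# → ∀ j →
    IsCoupling (plan (transports α ((1# - α) / deg) j)) (μ α (cyc (next j))) (μ α (cyc j))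
  transports-isCoupling {α} ½≤α α<1 j = plan-isCoupling
    (x≤y⇒0≤y-x (β≤α ½≤α) All.∷ 0≤β All.∷ 0≤β All.∷ 0≤β All.∷ All-map⁺ (All.universal (λ _ → 0≤β) leaves))
    (λ u → trans (sum-transports α β j (λ a b → δ a u))
      (trans
        (solve 6 (λ a b x y z s → (a :- b) :* x :+ (b :* x :+ (b :* y :+ (b :* z :+ b :* s))) :=
                                  a :* x :+ b :* (z :+ (y :+ s))) refl
          α β (δ (cyc (next j)) u) (δ (cyc j) u) (δ (cyc (next (next j))) u) (sumOver leaves (λ k → δ (leaf (next j) k) u)))
        (trans (+-congˡ (*-congˡ (+-congˡ (+-congʳ (reflexive (≡.cong (λ i → δ (cyc i) u) (≡.sym (prev-next j))))))))
          (sym (μ-cyc α (next j) u)))))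
    (λ v → trans (sum-transports α β j (λ a b → δ b v))
      (trans
        (solve 6 (λ a b x y z s → (a :- b) :* y :+ (b :* x :+ (b :* y :+ (b :* z :+ b :* s))) :=
                                  a :* y :+ b :* (x :+ (z :+ s))) refl
          α β (δ (cyc (next j)) v) (δ (cyc j) v) (δ (cyc (prev j)) v) (sumOver leaves (λ k → δ (leaf j k) v)))
        (sym (μ-cyc α j v))))
    where
    β = (1# - α) / deg
    0≤β : 0# ≤ β
    0≤β = inj₁ (*-pos (x<y⇒0<y-x α<1) (⁻¹-pos 0<deg))

  edge : ∀ x y → Adjacent x y → Star Adjacent x y
  edge x y x~y = x~y ◅ ε

  cyc~next : ∀ j → Adjacent (cyc j) (cyc (next j))
  cyc~next j = inj₁ ≡.refl

  next~cyc : ∀ j → Adjacent (cyc (next j)) (cyc j)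
  next~cyc j = inj₂ ≡.refl

  cycleWeight-pos : ∀ j → 0# < cycleWeight j
  cycleWeight-pos j = weight-pos {cyc j} {cyc (next j)} (cyc~next j)

  cycleWeight-sym : ∀ j → weight (cyc (next j)) (cyc j) ≈ cycleWeight j
  cycleWeight-sym j = weight-sym {cyc (next j)} {cyc j} (next~cyc j)

  leafWeight : Fin g → Fin (d ℕ.∸ 2) → Carrier
  leafWeight i k = weight (cyc i) (leaf i k)

  leafWeight-pos : ∀ i k → 0# < leafWeight i k
  leafWeight-pos i k = weight-pos {cyc i} {leaf i k} ≡.refl

  leafWeight-sym : ∀ i k → weight (leaf i k) (cyc i) ≈ leafWeight i k
  leafWeight-sym i k = weight-sym {leaf i k} {cyc i} ≡.refl

  leafTotal : Fin g → Carrier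
  leafTotal i = sumOver leaves (leafWeight i)

  leafTotal-pos : ∀ i → 0# < leafTotal i
  leafTotal-pos i = sumOver-pos {f = leafWeight i} (λ k → inj₁ (leafWeight-pos i k)) (∈-allFin k₀) (leafWeight-pos i k₀)
    where
    k₀ : Fin (d ℕ.∸ 2)
    -- `3 ≤ d` is read as `2 < d`, so every cycle vertex carries at least one leaf.
    k₀ = fromℕ< (ℕ.m<n⇒0<n∸m 3≤d)

  -- Curvature estimates from a 1-Lipschitz height function on the cycle.

  module Potential (f : Fin g → Carrier)
                   (f-lip⁻ : ∀ j → f j - f (next j) ≤ cycleWeight j)
                   (f-lip⁺ : ∀ j → f (next j) - f j ≤ cycleWeight j) where

    -- A leaf is attached by a single edge, so its height may differ from that of its base by the
    -- full leaf weight either way. `s` selects the direction at each cycle vertex, so that it can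
    -- be adapted to the edge under study.
    extend : (Fin g → Bool) → SunVertex → Carrier
    extend s (cyc i)    = f i
    extend s (leaf i k) = f i + (if s i then leafWeight i k else - leafWeight i k)

    private
      signed-≤ : ∀ b {a} → 0# < a → (if b then a else - a) ≤ a
      signed-≤ true  p = ≤-refl
      signed-≤ false {a} p = 0≤y-x⇒x≤y (≤-resp refl (solve 1 (λ a → a :+ a := a :- :- a) refl a) (0≤+ (inj₁ p) (inj₁ p)))

      neg-signed-≤ : ∀ b {a} → 0# < a → - (if b then a else - a) ≤ a
      neg-signed-≤ true  p = signed-≤ false p
      neg-signed-≤ false {a} p = inj₂ (solve 1 (λ a → :- :- a := a) refl a)

    extend-Lipschitz : ∀ s → Lipschitz (extend s)
    extend-Lipschitz s (cyc i) (cyc j) (inj₁ ≡.refl) = f-lip⁺ i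
    extend-Lipschitz s (cyc i) (cyc j) (inj₂ ≡.refl) = ≤-resp refl (sym (cycleWeight-sym j)) (f-lip⁻ j)
    extend-Lipschitz s (cyc i) (leaf j k) ≡.refl = ≤-resp
      (solve 2 (λ f x → x := f :+ x :- f) refl (f i) _) refl (signed-≤ (s i) (leafWeight-pos i k))
    extend-Lipschitz s (leaf i k) (cyc j) ≡.refl = ≤-resp
      (solve 2 (λ f x → :- x := f :- (f :+ x)) refl (f i) _) (sym (leafWeight-sym i k))
      (neg-signed-≤ (s i) (leafWeight-pos i k))

    drop : Fin g → Carrier
    drop j = f j - f (next j)

    -- deg * (Δ F (next j) - Δ F j), where Δ is the normalised Laplacian and F is the extension
    -- of f that increases along the leaves at j and decreases along those at next j.
    flux : Fin g → Carrier
    flux j = drop j + drop j - drop (next j) - drop (prev j) - leafTotal j - leafTotal (next j)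

    drop-prev : ∀ j → drop (prev j) ≈ f (prev j) - f j
    drop-prev j = +-congˡ (-‿cong (reflexive (≡.cong f (next-prev j))))

    -- Easy duality for the extended potential: the limiting point masses contribute the drop, and
    -- the mass `β` shifted to each neighbour contributes the Laplacian difference `flux j`.
    wasserstein-lower : ∀ {α} → ½ ≤ α → α < 1# → ∀ j →
      drop j - (1# - α) / deg * flux j ≤ wasserstein (μ α (cyc (next j))) (μ α (cyc j))
    wasserstein-lower {α} ½≤α α<1 j = ≤-resp eq refl
      (wasserstein-≥ (extend-Lipschitz s) (transports-isCoupling ½≤α α<1 j))
      where
      β = (1# - α) / deg
      s : Fin g → Bool
      -- Leaves fall at every vertex other than `j`; of these, only the ones at `next j` are charged
      -- by either measure.
      s i = does (i ≟ᶠ j)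
      F = extend s

      signed : ∀ {P : Set} (P? : Dec P) (a : Carrier) →
               (P → (if does P? then a else - a) ≡ a) × (¬ P → (if does P? then a else - a) ≡ - a)
      signed (yes p) a = (λ _ → ≡.refl) , (λ ¬p → contradiction p ¬p)
      signed (no ¬p) a = (λ p → contradiction p ¬p) , (λ _ → ≡.refl)

      leaves-at-j : sumOver leaves (λ k → F (leaf j k)) ≈ f j * leafCount + leafTotal j
      leaves-at-j = trans
        (sumOver-cong leaves (λ k → +-congˡ (reflexive (proj₁ (signed (j ≟ᶠ j) (leafWeight j k)) ≡.refl))))
        (trans (sumOver-+ leaves (λ _ → f j) (leafWeight j)) (+-congʳ (sumOver-const leaves (f j))))

      leaves-at-next : sumOver leaves (λ k → F (leaf (next j) k)) ≈ f (next j) * leafCount - leafTotal (next j)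
      leaves-at-next = trans
        (sumOver-cong leaves (λ k → +-congˡ (reflexive (proj₂ (signed (next j ≟ᶠ j) (leafWeight (next j) k))
          (λ eq → next≢id (ℕ.≤-trans (ℕ.s≤s (ℕ.s≤s ℕ.z≤n)) 3≤g) j (≡.sym eq))))))
        (trans (sumOver-- leaves (λ _ → f (next j)) (leafWeight (next j))) (+-congʳ (sumOver-const leaves (f (next j)))))

      eq : sumOver vertices (λ v → F v * μ α (cyc j) v) - sumOver vertices (λ v → F v * μ α (cyc (next j)) v)
           ≈ drop j - β * flux j
      eq = begin
        _ ≈⟨ +-cong (sum-μ α j F) (-‿cong (sum-μ α (next j) F)) ⟩
        (α * f j + β * (f (next j) + (f (prev j) + sumOver leaves (λ k → F (leaf j k))))) -
        (α * f (next j) + β * (f (next (next j)) + (f (prev (next j)) + sumOver leaves (λ k → F (leaf (next j) k)))))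
          -- Replacing `α` by `1# - deg * β` leaves a polynomial identity, in which the `leafCount`
          -- terms of `deg` cancel those of the leaf sums.
          ≈⟨ +-cong (+-cong (*-congʳ (α-β α)) (*-congˡ (+-congˡ (+-congˡ leaves-at-j))))
               (-‿cong (+-cong (*-congʳ (α-β α))
                 (*-congˡ (+-congˡ (+-cong (reflexive (≡.cong f (prev-next j))) leaves-at-next))))) ⟩
        ((1# - deg * β) * f j + β * (f (next j) + (f (prev j) + (f j * leafCount + leafTotal j)))) -
        ((1# - deg * β) * f (next j) + β * (f (next (next j)) + (f j + (f (next j) * leafCount - leafTotal (next j)))))
          ≈⟨ solve 8 (λ b n x y z p a c →
               ((con (+ 1) :- (con (+ 1) :+ (con (+ 1) :+ n)) :* b) :* x :+ b :* (y :+ (p :+ (x :* n :+ a)))) :-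
               ((con (+ 1) :- (con (+ 1) :+ (con (+ 1) :+ n)) :* b) :* y :+ b :* (z :+ (x :+ (y :* n :- c)))) :=
               (x :- y) :- b :* ((x :- y) :+ (x :- y) :- (y :- z) :- (p :- x) :- a :- c)) refl
               β leafCount (f j) (f (next j)) (f (next (next j))) (f (prev j)) (leafTotal j) (leafTotal (next j)) ⟩
        drop j - β * (drop j + drop j - drop (next j) - (f (prev j) - f j) - leafTotal j - leafTotal (next j))
          ≈⟨ +-congˡ (-‿cong (*-congˡ (+-congʳ (+-congʳ (+-congˡ (-‿cong (sym (drop-prev j)))))))) ⟩
        drop j - β * flux j ∎

    drop-≤-dist : ∀ j → drop j ≤ dist (cyc (next j)) (cyc j)
    drop-≤-dist j = dist-≥ (extend-Lipschitz (λ _ → true)) (cyc (next j)) (cyc j)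

    neg-drop-≤-dist : ∀ j → - drop j ≤ dist (cyc (next j)) (cyc j)
    neg-drop-≤-dist j = ≤-resp (solve 2 (λ x y → :- x :- :- y := :- (x :- y)) refl (f j) (f (next j))) refl
      (dist-≥ (Lipschitz-neg (extend-Lipschitz (λ _ → true))) (cyc (next j)) (cyc j))

    -- On edges where the height drop equals the weight, the weight of a forward walk telescopes to
    -- a height difference.
    descend : ∀ k i → (∀ m → m ℕ.< k → drop (next^ m i) ≈ cycleWeight (next^ m i)) →
              Σ[ p ∈ Star Adjacent (cyc i) (cyc (next^ k i)) ] pathWeight p ≈ f i - f (next^ k i)
    descend zero    i tight = ε , solve 1 (λ x → con (+ 0) := x :- x) refl (f i)
    descend (suc k) i tight with descend k i (λ m m<k → tight m (ℕ.m<n⇒m<1+n m<k))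
    ... | p , p≈ = p ◅◅ edge (cyc j) (cyc (next j)) (cyc~next j)
        , (begin
      pathWeight (p ◅◅ edge (cyc j) (cyc (next j)) (cyc~next j))
        ≈⟨ pathWeight-◅◅ p (edge (cyc j) (cyc (next j)) (cyc~next j)) ⟩
      pathWeight p + (cycleWeight j + 0#)                   ≈⟨ +-cong p≈ (+-congʳ (sym (tight k (ℕ.n<1+n k)))) ⟩
      (f i - f j) + ((f j - f (next j)) + 0#)
        ≈⟨ solve 3 (λ x y z → (x :- y) :+ ((y :- z) :+ con (+ 0)) := x :- z) refl (f i) (f j) (f (next j)) ⟩
      f i - f (next j)                                      ∎)
      where
      j = next^ k i

    -- Tightness squeezes the distance: the potential bounds it below by `drop j`, the edge itself
    -- bounds it above by the same number.
    curvature-upper : ∀ {κ j} → HasCurvature (cyc (next j)) (cyc j) κ → drop j ≈ cycleWeight j →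
                      κ * (deg * drop j) ≤ flux j
    curvature-upper {κ} {j} curv tight = ≤-resp (*-congˡ (*-congˡ dist≈)) refl
      (curvature-≤ curv 0<deg (<-resp refl (trans (sym tight) (sym dist≈)) (cycleWeight-pos j))
        λ α ½≤α α<1 → ≤-resp (+-congʳ (sym dist≈)) refl (wasserstein-lower ½≤α α<1 j))
      where
      dist≈ : dist (cyc (next j)) (cyc j) ≈ drop j
      dist≈ = ≤-antisym
        (≤-resp refl (trans (+-identityʳ _) (trans (cycleWeight-sym j) (sym tight)))
          (dist-≤ (edge (cyc (next j)) (cyc j) (next~cyc j))))
        (drop-≤-dist j)

    -- The transport estimate at the one edge where the height rises.

    module _ (i₀ : Fin g) (tight : ∀ j → j ≢ i₀ → drop j ≈ cycleWeight j) (rise : 0# < - drop i₀) where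

      private
        -- A forward walk of `k` edges that starts `r` steps after `i₀` avoids the edge `i₀` as long
        -- as `0 < r` and `r + k ≤ g`.
        tight-from : ∀ r k → 0 ℕ.< r → r ℕ.+ k ℕ.≤ g → ∀ {i} → (∀ m → next^ m i ≡ next^ (r ℕ.+ m) i₀) →
                     ∀ m → m ℕ.< k → drop (next^ m i) ≈ cycleWeight (next^ m i)
        tight-from r k 0<r r+k≤g {i} shift m m<k = tight (next^ m i) λ eq →
          next^-≢ {k = r ℕ.+ m} i₀ (ℕ.<-≤-trans 0<r (ℕ.m≤m+n r m))
            (ℕ.<-≤-trans (ℕ.+-monoʳ-< r m<k) r+k≤g) (≡.trans (≡.sym (shift m)) eq)

        -- The complementary arc: `g - 1` tight edges lead from `next i₀` back to `i₀`. Together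
        -- with the negated potential it determines the distance of the two ends.
        around : Σ[ p ∈ Star Adjacent (cyc (next i₀)) (cyc i₀) ] pathWeight p ≈ - drop i₀
        around =
          let p , p≈ = ≡.subst (λ i → Σ[ p ∈ Star Adjacent (cyc (next i₀)) (cyc i) ] pathWeight p ≈ f (next i₀) - f i)
                (prev-next i₀)
                (descend (g ℕ.∸ 1) (next i₀) (tight-from 1 (g ℕ.∸ 1) (ℕ.s≤s ℕ.z≤n)
                  (ℕ.≤-reflexive (ℕ.m+[n∸m]≡n (ℕ.≤-trans (ℕ.s≤s ℕ.z≤n) 3≤g))) (λ m → next^-next m i₀)))
          in p , trans p≈ (solve 2 (λ x y → y :- x := :- (x :- y)) refl (f i₀) (f (next i₀)))

        -- The same arc with one edge cut off at each end, so `g - 3` edges; for `g = 3` the walk is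
        -- empty.
        inner : dist (cyc (next (next i₀))) (cyc (prev i₀)) ≤ f (next (next i₀)) - f (prev i₀)
        inner = ≡.subst (λ i → dist (cyc (next (next i₀))) (cyc i) ≤ f (next (next i₀)) - f i) end
          (let p , p≈ = descend (g ℕ.∸ 3) (next (next i₀)) (tight-from 2 (g ℕ.∸ 3) (ℕ.s≤s ℕ.z≤n)
                 (ℕ.≤-trans (ℕ.n≤1+n _) (ℕ.≤-reflexive 3+k)) shift)
           in ≤-resp refl p≈ (dist-≤ p))
          where
          shift : ∀ m → next^ m (next (next i₀)) ≡ next^ (2 ℕ.+ m) i₀
          shift m = ≡.trans (next^-next m (next i₀)) (≡.cong next (next^-next m i₀))
          3+k : 3 ℕ.+ (g ℕ.∸ 3) ≡ g
          3+k = ℕ.m+[n∸m]≡n 3≤g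
          end : next^ (g ℕ.∸ 3) (next (next i₀)) ≡ prev i₀
          -- `prev i₀` is `g - 1` steps after `i₀`, and `2 + (g - 3)` is `(3 + (g - 3)) - 1` by
          -- computation.
          end = ≡.trans (shift (g ℕ.∸ 3)) (≡.cong (λ m → next^ (m ℕ.∸ 1) i₀) 3+k)

        leaf-dist : ∀ k → dist (leaf (next i₀) k) (leaf i₀ k) ≤ leafWeight (next i₀) k - drop i₀ + leafWeight i₀ k
        leaf-dist k = ≤-resp refl
          (begin
            pathWeight (up ◅◅ (p ◅◅ down))
              ≈⟨ trans (pathWeight-◅◅ up (p ◅◅ down)) (+-congˡ (trans (pathWeight-◅◅ p down) (+-congʳ p≈))) ⟩
            (weight (leaf (next i₀) k) (cyc (next i₀)) + 0#) + (- drop i₀ + (leafWeight i₀ k + 0#))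
              ≈⟨ +-congʳ (+-congʳ (leafWeight-sym (next i₀) k)) ⟩
            (leafWeight (next i₀) k + 0#) + (- drop i₀ + (leafWeight i₀ k + 0#))
              ≈⟨ solve 3 (λ x y z → (x :+ con (+ 0)) :+ (y :+ (z :+ con (+ 0))) := x :+ y :+ z) refl
                   (leafWeight (next i₀) k) (- drop i₀) (leafWeight i₀ k) ⟩
            leafWeight (next i₀) k - drop i₀ + leafWeight i₀ k ∎)
          (dist-≤ (up ◅◅ (p ◅◅ down)))
          where
          p    = proj₁ around
          p≈   = proj₂ around
          up   = edge (leaf (next i₀) k) (cyc (next i₀)) ≡.refl
          down = edge (cyc i₀) (leaf i₀ k) ≡.refl

        dist≈ : dist (cyc (next i₀)) (cyc i₀) ≈ - drop i₀
        dist≈ = ≤-antisym (≤-resp refl (proj₂ around) (dist-≤ (proj₁ around))) (neg-drop-≤-dist i₀)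

        -- `flux i₀` contains minus this amount, whereas leaf-to-leaf moves cost plus this amount;
        -- hence it enters the bounds below twice.
        excess : Carrier
        excess = leafTotal i₀ + leafTotal (next i₀)

        cost-upper : ∀ {α} → ½ ≤ α → α < 1# → let β = (1# - α) / deg in
          cost (plan (transports α β i₀)) ≤ - drop i₀ - β * - (flux i₀ + (excess + excess))
        cost-upper {α} ½≤α α<1 = ≤-resp
          (sym (trans (plan-cost (transports α β i₀)) (sum-transports α β i₀ dist))) eq
          (+-mono-≤ (*-monoˡ-≤ (x≤y⇒0≤y-x (β≤α ½≤α)) (inj₂ dist≈))
            -- The two stationary entries are free: the empty walk bounds their distances by `0#`.
            (+-mono-≤ (*-monoˡ-≤ 0≤β (dist-≤ ε)) (+-mono-≤ (*-monoˡ-≤ 0≤β (dist-≤ ε))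
              (+-mono-≤ (*-monoˡ-≤ 0≤β inner) (*-monoˡ-≤ 0≤β (sumOver-mono leaves leaf-dist))))))
          where
          β = (1# - α) / deg
          0≤β : 0# ≤ β
          0≤β = inj₁ (*-pos (x<y⇒0<y-x α<1) (⁻¹-pos 0<deg))
          A  = leafTotal i₀
          A′ = leafTotal (next i₀)

          sum-leaf : sumOver leaves (λ k → leafWeight (next i₀) k - drop i₀ + leafWeight i₀ k) ≈
                     A′ + - drop i₀ * leafCount + A
          sum-leaf = trans (sumOver-+ leaves (λ k → leafWeight (next i₀) k - drop i₀) (leafWeight i₀))
            (+-congʳ (trans (sumOver-+ leaves (leafWeight (next i₀)) (λ _ → - drop i₀))
              (+-congˡ (sumOver-const leaves (- drop i₀)))))

          eq : (α - β) * - drop i₀ + (β * 0# + (β * 0# + (β * (f (next (next i₀)) - f (prev i₀)) +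
                 β * sumOver leaves (λ k → leafWeight (next i₀) k - drop i₀ + leafWeight i₀ k))))
               ≈ - drop i₀ - β * - (flux i₀ + (excess + excess))
          eq = begin
            _ ≈⟨ +-cong (*-congʳ (+-congʳ (α-β α))) (+-congˡ (+-congˡ (+-congˡ (*-congˡ sum-leaf)))) ⟩
            (1# - deg * β - β) * - drop i₀ + (β * 0# + (β * 0# + (β * (f (next (next i₀)) - f (prev i₀)) +
              β * (A′ + - drop i₀ * leafCount + A))))
              ≈⟨ solve 8 (λ b n x y z p a c →
                   (con (+ 1) :- (con (+ 1) :+ (con (+ 1) :+ n)) :* b :- b) :* :- (x :- y) :+
                     (b :* con (+ 0) :+ (b :* con (+ 0) :+ (b :* (z :- p) :+ b :* (c :+ :- (x :- y) :* n :+ a)))) :=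
                   :- (x :- y) :- b :* :- (((x :- y) :+ (x :- y) :- (y :- z) :- (p :- x) :- a :- c) :+ ((a :+ c) :+ (a :+ c)))) refl
                   β leafCount (f i₀) (f (next i₀)) (f (next (next i₀))) (f (prev i₀)) A A′ ⟩
            - drop i₀ - β * - (drop i₀ + drop i₀ - drop (next i₀) - (f (prev i₀) - f i₀) - A - A′ + (excess + excess))
              ≈⟨ +-congˡ (-‿cong (*-congˡ (-‿cong (+-congʳ (+-congʳ (+-congʳ (+-congˡ (-‿cong (sym (drop-prev i₀)))))))))) ⟩
            - drop i₀ - β * - (flux i₀ + (excess + excess)) ∎

      -- The plan bounds `κ` times the positive distance `- drop i₀` from below; negation turns this
      -- into an upper bound of the same shape as `curvature-upper`.
      curvature-lower : ∀ {κ} → HasCurvature (cyc (next i₀)) (cyc i₀) κ →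
                        κ * (deg * drop i₀) ≤ flux i₀ + (excess + excess)
      curvature-lower {κ} curv = ≤-resp
        (trans (-‿cong (*-congˡ (*-congˡ dist≈))) (solve 3 (λ k n x → :- (k :* (n :* :- x)) := k :* (n :* x)) refl κ deg (drop i₀)))
        (solve 1 (λ x → :- :- x := x) refl _)
        (neg-mono-≤ (curvature-≥ curv 0<deg (<-resp refl (sym dist≈) rise)
          λ α ½≤α α<1 → ≤-trans (wasserstein-≤ (transports-isCoupling ½≤α α<1 i₀))
            (≤-resp refl (+-congʳ (sym dist≈)) (cost-upper ½≤α α<1))))

  -- Summing the edge estimates around the cycle.

  not-constant-curvature : ∀ i₀ → cycleLength ≤ cycleWeight i₀ + cycleWeight i₀ →
    ∀ κ → ¬ (∀ x y → Adjacent x y → HasCurvature x y κ)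
  not-constant-curvature i₀ long κ curv = ≤⇒≯ 0≤total total<0
    where
    next≢ : ∀ j → next j ≢ j
    next≢ j = next^-≢ {k = 1} j (ℕ.s≤s ℕ.z≤n) (ℕ.≤-trans (ℕ.s≤s (ℕ.s≤s ℕ.z≤n)) 3≤g)

    next²≢ : ∀ j → next (next j) ≢ j
    next²≢ j = next^-≢ {k = 2} j (ℕ.s≤s ℕ.z≤n) 3≤g

    two-<-∑ : ∀ {h : Fin g → Carrier} → (∀ i → 0# < h i) → h i₀ + h (next i₀) < ∑ h
    two-<-∑ 0<h = ∑->-two 0<h (λ eq → next≢ i₀ (≡.sym eq)) (next²≢ i₀) (next≢ (next i₀))

    W<L : cycleWeight i₀ < cycleLength
    W<L = <-trans (0<y-x⇒x<y (<-resp refl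
        (solve 2 (λ a b → b := a :+ b :- a) refl (cycleWeight i₀) (cycleWeight (next i₀))) (cycleWeight-pos (next i₀))))
      (two-<-∑ cycleWeight-pos)

    0≤L : 0# ≤ cycleLength
    0≤L = inj₁ (<-trans (cycleWeight-pos i₀) W<L)

    -- Subtracting the whole length at `i₀` makes the total vanish and replaces the weight there by
    -- minus the length of the complementary arc.
    e : Fin g → Carrier
    e j = cycleWeight j - cycleLength * δᶠ i₀ j

    e-i₀ : e i₀ ≈ cycleWeight i₀ - cycleLength
    e-i₀ = +-congˡ (-‿cong (trans (*-congˡ (reflexive (δᶠ-refl i₀))) (trans (*-comm _ _) (*-identityˡ _))))

    e-other : ∀ j → j ≢ i₀ → e j ≈ cycleWeight j
    e-other j j≢i₀ = trans (+-congˡ (-‿cong (*-congˡ (reflexive (δᶠ-≢ j≢i₀)))))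
      (solve 2 (λ x l → x :- l :* con (+ 0) := x) refl (cycleWeight j) cycleLength)

    ∑e≈0 : ∑ e ≈ 0#
    ∑e≈0 = trans (sumOver-- (allFin g) cycleWeight (λ j → cycleLength * δᶠ i₀ j))
      (trans (+-congˡ (-‿cong (∑-δ i₀ (λ _ → cycleLength)))) (solve 1 (λ l → l :- l := con (+ 0)) refl cycleLength))

    f : Fin g → Carrier
    f = proj₁ (coboundary e ∑e≈0)

    f-drop : ∀ j → f j - f (next j) ≈ e j
    f-drop = proj₂ (coboundary e ∑e≈0)

    f-lip⁻ : ∀ j → f j - f (next j) ≤ cycleWeight j
    f-lip⁻ j = ≤-resp (sym (f-drop j)) refl (0≤y-x⇒x≤y (≤-resp refl
      (solve 2 (λ x y → y := x :- (x :- y)) refl (cycleWeight j) (cycleLength * δᶠ i₀ j))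
      (0≤* 0≤L (indicator-nonneg (does (j ≟ᶠ i₀))))))

    -e≤ : ∀ j → Dec (j ≡ i₀) → - e j ≤ cycleWeight j
    -- At `i₀` the claim is that the complementary arc is at most as long as the edge, which is
    -- `long`.
    -e≤ j (yes ≡.refl) = ≤-resp (-‿cong (sym e-i₀)) refl (0≤y-x⇒x≤y (≤-resp refl
      (solve 2 (λ x l → x :+ x :- l := x :- :- (x :- l)) refl (cycleWeight i₀) cycleLength) (x≤y⇒0≤y-x long)))
    -e≤ j (no j≢i₀) = ≤-resp (-‿cong (sym (e-other j j≢i₀))) refl (0≤y-x⇒x≤y (≤-resp refl
      (solve 1 (λ x → x :+ x := x :- :- x) refl (cycleWeight j))
      (0≤+ (inj₁ (cycleWeight-pos j)) (inj₁ (cycleWeight-pos j)))))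

    f-lip⁺ : ∀ j → f (next j) - f j ≤ cycleWeight j
    f-lip⁺ j = ≤-resp
      (trans (-‿cong (sym (f-drop j))) (solve 2 (λ x y → :- (x :- y) := y :- x) refl (f j) (f (next j)))) refl
      (-e≤ j (j ≟ᶠ i₀))

    open Potential f f-lip⁻ f-lip⁺

    tight : ∀ j → j ≢ i₀ → drop j ≈ cycleWeight j
    tight j j≢i₀ = trans (f-drop j) (e-other j j≢i₀)

    rise : 0# < - drop i₀
    rise = <-resp refl
      (trans (solve 2 (λ x l → l :- x := :- (x :- l)) refl (cycleWeight i₀) cycleLength)
        (-‿cong (trans (sym e-i₀) (sym (f-drop i₀)))))
      (x<y⇒0<y-x W<L)

    pair : Fin g → Carrier
    pair j = leafTotal j + leafTotal (next j)

    -- The delta factor merges both kinds of estimate into one formula that can be summed over all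
    -- `j`.
    bound : ∀ j → Dec (j ≡ i₀) → κ * (deg * drop j) ≤ flux j + (pair j + pair j) * δᶠ i₀ j
    bound j (yes ≡.refl) = ≤-resp refl
      (+-congˡ (trans (sym (*-identityˡ _)) (trans (*-comm _ _) (*-congˡ (reflexive (≡.sym (δᶠ-refl j)))))))
      (curvature-lower i₀ tight rise (curv (cyc (next i₀)) (cyc i₀) (next~cyc i₀)))
    bound j (no j≢i₀) = ≤-resp refl
      (trans (solve 2 (λ x y → x := x :+ y :* con (+ 0)) refl (flux j) (pair j + pair j))
        (+-congˡ (*-congˡ (reflexive (≡.sym (δᶠ-≢ j≢i₀))))))
      (curvature-upper (curv (cyc (next j)) (cyc j) (next~cyc j)) (tight j j≢i₀))

    total : Carrier
    total = ∑ (λ j → flux j + (pair j + pair j) * δᶠ i₀ j)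

    ∑drop : ∑ drop ≈ 0#
    ∑drop = trans (sumOver-cong (allFin g) f-drop) ∑e≈0

    0≤total : 0# ≤ total
    0≤total = ≤-resp
      (trans (sumOver-*ˡ (allFin g) κ (λ j → deg * drop j)) (trans (*-congˡ (trans (sumOver-*ˡ (allFin g) deg drop)
        (trans (*-congˡ ∑drop) (zeroʳ deg)))) (zeroʳ κ)))
      refl (sumOver-mono (allFin g) (λ j → bound j (j ≟ᶠ i₀)))

    -- By shift invariance each drop term sums to zero, and every leaf total is met at both cycle
    -- edges of its vertex.
    ∑flux : ∑ flux ≈ 0# + 0# - 0# - 0# - ∑ leafTotal - ∑ leafTotal
    ∑flux = trans (∑-- (λ j → drop j + drop j - drop (next j) - drop (prev j) - leafTotal j) (λ j → leafTotal (next j)))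
      (+-cong
        (trans (∑-- (λ j → drop j + drop j - drop (next j) - drop (prev j)) leafTotal) (+-congʳ
          (trans (∑-- (λ j → drop j + drop j - drop (next j)) (λ j → drop (prev j))) (+-cong
            (trans (∑-- (λ j → drop j + drop j) (λ j → drop (next j))) (+-cong
              (trans (sumOver-+ (allFin g) drop drop) (+-cong ∑drop ∑drop))
              (-‿cong (trans (∑-next drop) ∑drop))))
            (-‿cong (trans (∑-prev drop) ∑drop))))))
        (-‿cong (∑-next leafTotal)))
      where
      ∑-- : ∀ (h h′ : Fin g → Carrier) → ∑ (λ j → h j - h′ j) ≈ ∑ h - ∑ h′
      ∑-- = sumOver-- (allFin g)

    total<0 : total < 0#
    total<0 = 0<y-x⇒x<y (<-resp refl
      (sym (trans (+-congˡ (-‿cong (trans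
          (sumOver-+ (allFin g) flux (λ j → (pair j + pair j) * δᶠ i₀ j))
          (+-cong ∑flux (∑-δ i₀ (λ j → pair j + pair j))))))
        (solve 2 (λ s p → con (+ 0) :- ((con (+ 0) :+ con (+ 0) :- con (+ 0) :- con (+ 0) :- s :- s) :+ (p :+ p)) :=
                          (s :- p) :+ (s :- p)) refl (∑ leafTotal) (pair i₀))))
      (0<+ slack (inj₁ slack)))
      where
      -- Strict because `next (next i₀)` is a third cycle vertex and its leaves have positive total
      -- weight.
      slack : 0# < ∑ leafTotal - pair i₀
      slack = x<y⇒0<y-x (two-<-∑ leafTotal-pos)

  nonGeodesic⇒long : ∀ i → 1# / fromℕ 2 * cycleLength < cycleWeight i → cycleLength ≤ cycleWeight i + cycleWeight i
  nonGeodesic⇒long i half = inj₁ (0<y-x⇒x<y (<-resp refl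
    (begin
      t * (W - 1# * t ⁻¹ * L)   ≈⟨ solve 4 (λ t h w l → t :* (w :- con (+ 1) :* h :* l) := t :* w :- t :* h :* l) refl t (t ⁻¹) W L ⟩
      t * W - t * t ⁻¹ * L      ≈⟨ +-congˡ (-‿cong (*-congʳ (*-inverse 0<t))) ⟩
      -- `fromℕ 2` unfolds to `1# + (1# + 0#)`, which is the shape given to the solver.
      t * W - 1# * L            ≈⟨ solve 2 (λ w l → (con (+ 1) :+ (con (+ 1) :+ con (+ 0))) :* w :- con (+ 1) :* l := w :+ w :- l) refl W L ⟩
      W + W - L                 ∎)
    (*-pos 0<t (x<y⇒0<y-x half))))
    where
    t = fromℕ 2
    W = cycleWeight i
    L = cycleLength
    0<t : 0# < t
    0<t = 0<+ 0<1 (0≤+ (inj₁ 0<1) ≤-refl)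

open import Data.Nat.Base using (_≤_)

proposition7p10 : (ℝ : CompleteOrderedField) (g d : ℕ) (3≤g : 3 ≤ g) → 3 ≤ d →
    ¬ (Σ[ w ∈ Weighting ℝ (sunGraph g d 3≤g) ]
    (LinLuYau.IsEinstein ℝ (sunGraph g d 3≤g) w × CycleEdges.HasNonGeodesicCycleEdge ℝ g d 3≤g w))
proposition7p10 ℝ g d 3≤g 3≤d (w , (κ , curv) , i₀ , half) =
  not-constant-curvature i₀ (nonGeodesic⇒long i₀ half) κ curv
  where open SunTransport ℝ g d 3≤g 3≤d w
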